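{- Assuming the Orthogonal Vectors Conjecture, for any constant $\epsilon>0$ there is no algorithm that, given any straight-line grammar (SLG) $G=(V,\Sigma,R,S)$ representing a string $T\in\Sigma^{N}$, where $\Sigma=\{1,\ldots,\sigma\}$ and $\sigma=\Omega((N/\log N)^{1/2})$, answers any batch of $m=\Omega(|G|/\log N)$ range distinct count queries on $T$ in $O(m|G|^{1-\epsilon}\log^{O(1)}N)$ time.
   Context: **Model and asymptotics.** Running times are in the standard word RAM model with machine words of $\Theta(\log n)$ bits ($n$ the input-size parameter), where standard arithmetic and bitwise operations take $O(1)$ time. $\log^{O(1)}N$ means $(\log N)^c$ for some constant $c$. The conditions $\sigma=\Omega((N/\log N)^{1/2})$ and $m=\Omega(|G|/\log N)$ restrict the inputs the algorithm must handle to those with $\sigma\ge\kappa(N/\log N)^{1/2}$ and $m\ge\kappa|G|/\log N$ for a fixed constant $\kappa>0$. **Orthogonal Vectors (OV).** Input: a set $A\subseteq\{0,1\}^d$ with $|A|=n$. Output: whether there exist $x,y\in A$ with $\langle x,y\rangle=\sum_{i=1}^d x[i]\,y[i]=0$. **Orthogonal Vectors Conjecture:** for every constant $\epsilon>0$ there exists a constant $c\ge1$ such that OV cannot be solved in $O(n^{2-\epsilon})$ time on instances with $d=c\log n$. **Straight-line grammars.** An SLG is a context-free grammar $G=(V,\Sigma,R,S)$ (nonterminals $V$, terminals $\Sigma$, $V\cap\Sigma=\emptyset$, rules $R\subseteq V\times(V\cup\Sigma)^*$, start symbol $S\in V$) such that each $N\in V$ has exactly one rule $(N,\gamma)\in R$,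 whose right-hand side $\gamma$ is denoted $\mathrm{rhs}_G(N)$, and there is an ordering $N_1,\ldots,N_{|V|}$ of $V$ with $\mathrm{rhs}_G(N_i)\in(\{N_{i+1},\ldots,N_{|V|}\}\cup\Sigma)^*$ for all $i$. Hence $G$ generates (represents) exactly one string. The size of $G$ is $|G|=\sum_{N\in V}\max(|\mathrm{rhs}_G(N)|,1)$. **Range distinct count query.** Strings are indexed from $1$. For $T\in\Sigma^N$ and $b,e\in\{0,\ldots,N\}$, the query asks for $\mathrm{distinct}_T(b,e)=|\{T[i]: b<i\le e\}|$. -}

module Defs where

open import Data.Bool.Base using (Bool; if_then_else_; _∧_; _∨_; _xor_)
open import Data.Fin.Base as Fin using (Fin; toℕ)
import Data.Fin.Properties as Fin
open import Data.Fin.Permutation using (Permutation′; _⟨$⟩ʳ_)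
open import Data.Integer.Base using (∣_∣)
open import Data.List.Base using (List; []; _∷_; _++_; map; concatMap; length; lookup; take; drop; sum; allFin; deduplicate)
open import Data.List.Membership.Propositional using (_∈_)
open import Data.Nat.Base using (ℕ; zero; suc; _+_; _*_; _∸_; _^_; _⊔_; _≤_; _<ᵇ_; _≡ᵇ_; ⌊_/2⌋)
open import Data.Nat.DivMod using (_/_; _%_)
open import Data.Nat.Logarithm using (⌈log₂_⌉)
open import Data.Nat.Properties using (m^n≢0)
open import Data.Product.Base using (Σ; ∃; ∃-syntax; ∃₂; _×_; _,_; proj₁; proj₂)
open import Data.Rational.Base using (ℚ; 0ℚ; ↥_; ↧ₙ_) renaming (_<_ to _<ℚ_)
open import Data.Sum.Base using (_⊎_; inj₁; inj₂)
open import Data.Vec.Base as Vec using (Vec)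
import Data.Vec.Membership.Propositional as Vec
open import Data.Vec.Relation.Unary.Unique.Propositional using (Unique)
open import Relation.Binary.Construct.Closure.ReflexiveTransitive using (Star)
open import Relation.Binary.PropositionalEquality.Core using (_≡_; _≢_)
open import Relation.Nullary.Negation.Core using (¬_)

------------------------------------------------------------------------
-- Word RAM
--
-- Words of w bits are the naturals below 2 ^ w.  A machine has word
-- registers and a word-addressed memory; a program, being finite, mentions
-- finitely many registers.  Control flow is structured (if / while) rather
-- than by jumps; a jump program is simulated with constant-factor overhead
-- by one while loop over a register holding its program counter.

data Op : Set where
  add sub mul div mod and or xor shl shr eq lt : Op

fromBool : Bool → ℕ
fromBool b = if b then 1 else 0

bitwise : (Bool → Bool → Bool) → (w : ℕ) → ℕ → ℕ → ℕ
bitwise f zero    a b = 0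
bitwise f (suc w) a b =
  fromBool (f (a % 2 ≡ᵇ 1) (b % 2 ≡ᵇ 1)) + 2 * bitwise f w ⌊ a /2⌋ ⌊ b /2⌋

reduce : ℕ → ℕ → ℕ
reduce w a = _%_ a (2 ^ w) {{m^n≢0 2 w}}

-- Arithmetic is modulo 2 ^ w; division and remainder by 0 give 0.
⟦_⟧ : Op → (w : ℕ) → ℕ → ℕ → ℕ
⟦ add ⟧ w a b       = reduce w (a + b)
⟦ sub ⟧ w a b       = reduce w (a + (2 ^ w ∸ b))
⟦ mul ⟧ w a b       = reduce w (a * b)
⟦ div ⟧ w a zero    = 0
⟦ div ⟧ w a (suc b) = reduce w (a / suc b)
⟦ mod ⟧ w a zero    = 0
⟦ mod ⟧ w a (suc b) = reduce w (a % suc b)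
⟦ and ⟧ w a b       = bitwise _∧_ w a b
⟦ or  ⟧ w a b       = bitwise _∨_ w a b
⟦ xor ⟧ w a b       = bitwise _xor_ w a b
⟦ shl ⟧ w a b       = reduce w (a * 2 ^ b)
⟦ shr ⟧ w a b       = reduce w (_/_ a (2 ^ b) {{m^n≢0 2 b}})
⟦ eq  ⟧ w a b       = reduce w (fromBool (a ≡ᵇ b))
⟦ lt  ⟧ w a b       = reduce w (fromBool (a <ᵇ b))

infixr 5 _⨾_

data Program : Set where
  skip  : Program
  const : (r k : ℕ) → Program                  -- R[r] ← k
  op    : Op → (r a b : ℕ) → Program           -- R[r] ← R[a] ∘ R[b]
  load  : (r a : ℕ) → Program                  -- R[r] ← M[R[a]]
  store : (a r : ℕ) → Program                  -- M[R[a]] ← R[r]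
  _⨾_   : Program → Program → Program
  ifnz  : ℕ → Program → Program → Program      -- test R[r] ≠ 0
  while : ℕ → Program → Program                -- loop while R[r] ≠ 0

record State : Set where
  constructor ⟨_,_⟩
  field
    reg : ℕ → ℕ
    mem : ℕ → ℕ

open State public

_[_↦_] : (ℕ → ℕ) → ℕ → ℕ → (ℕ → ℕ)
(f [ i ↦ v ]) j = if j ≡ᵇ i then v else f j

-- w ⊢ p , s ⇓[ t ] s′ : with w-bit words, p started in state s halts in
-- state s′ after t steps; every instruction and every test costs 1.
data _⊢_,_⇓[_]_ (w : ℕ) : Program → State → ℕ → State → Set where
  skip⇓   : ∀ {s} → w ⊢ skip , s ⇓[ 1 ] s
  const⇓  : ∀ {s r k} →
            w ⊢ const r k , s ⇓[ 1 ] ⟨ reg s [ r ↦ reduce w k ] , mem s ⟩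
  op⇓     : ∀ {s o r a b} →
            w ⊢ op o r a b , s ⇓[ 1 ]
              ⟨ reg s [ r ↦ ⟦ o ⟧ w (reg s a) (reg s b) ] , mem s ⟩
  load⇓   : ∀ {s r a} →
            w ⊢ load r a , s ⇓[ 1 ] ⟨ reg s [ r ↦ mem s (reg s a) ] , mem s ⟩
  store⇓  : ∀ {s a r} →
            w ⊢ store a r , s ⇓[ 1 ] ⟨ reg s , mem s [ reg s a ↦ reg s r ] ⟩
  seq⇓    : ∀ {p q s s′ s″ t u} →
            w ⊢ p , s ⇓[ t ] s′ → w ⊢ q , s′ ⇓[ u ] s″ →
            w ⊢ p ⨾ q , s ⇓[ t + u ] s″
  ifnz⇓   : ∀ {r p q s s′ t} → reg s r ≢ 0 → w ⊢ p , s ⇓[ t ] s′ →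
            w ⊢ ifnz r p q , s ⇓[ 1 + t ] s′
  ifz⇓    : ∀ {r p q s s′ t} → reg s r ≡ 0 → w ⊢ q , s ⇓[ t ] s′ →
            w ⊢ ifnz r p q , s ⇓[ 1 + t ] s′
  while⇓  : ∀ {r p s s′ s″ t u} → reg s r ≢ 0 →
            w ⊢ p , s ⇓[ t ] s′ → w ⊢ while r p , s′ ⇓[ u ] s″ →
            w ⊢ while r p , s ⇓[ 1 + (t + u) ] s″
  done⇓   : ∀ {r p s} → reg s r ≡ 0 → w ⊢ while r p , s ⇓[ 1 ] s

-- The i-th entry (from 0), or 0 past the end.
cell : List ℕ → ℕ → ℕ
cell []       i       = 0
cell (x ∷ xs) zero    = x
cell (x ∷ xs) (suc i) = cell xs i

-- Initial states: input at addresses 0, 1, …, everything else zero.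
Loaded : List ℕ → State → Set
Loaded xs s = (∀ r → reg s r ≡ 0) × (∀ i → mem s i ≡ cell xs i)

------------------------------------------------------------------------
-- Problems and running times

record Problem : Set₁ where
  field
    Instance : Set
    size     : Instance → ℕ                    -- words have Θ(log size) bits
    input    : Instance → List ℕ
    Correct  : Instance → (ℕ → ℕ) → Set        -- on the final memory

-- The problem Π on those instances that satisfy P.
restrict : (Π : Problem) → (Problem.Instance Π → Set) → Problem
restrict Π P = record
  { Instance = Σ Instance P
  ; size     = λ x → size (proj₁ x)
  ; input    = λ x → input (proj₁ x)
  ; Correct  = λ x → Correct (proj₁ x)
  }
  where open Problem Π

-- Some program solves Π with a running time in the class 𝒪 when words have
-- Θ(log size) bits.  The program fixes how many bits it needs, as a
-- multiple c₀ of log size; it then has to work for every word length w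
-- between c₀ log size and c₁ log size, whatever the constant c₁, and the
-- constants hidden in the running time may depend on c₁.
SolvableIn : (Π : Problem) → ((Problem.Instance Π → ℕ) → Set) → Set
SolvableIn Π 𝒪 =
  Σ Program λ p → ∃[ c₀ ] 1 ≤ c₀ × (∀ c₁ → ∃[ f ] 𝒪 f ×
    (∀ x w → c₀ * ⌈log₂ size x ⌉ ≤ w → w ≤ c₁ * ⌈log₂ size x ⌉ →
     ∀ s → Loaded (input x) s →
     ∃₂ λ t s′ → (w ⊢ p , s ⇓[ t ] s′) × t ≤ f x × Correct x (mem s′)))
  where open Problem Π

-- For ε = p / q > 0: the inequality t ≤ B · x ^ (- ε), raised to the power q
-- and multiplied by x ^ p.
infix 4 _≤_·_^-_

_≤_·_^-_ : ℕ → ℕ → ℕ → ℚ → Set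
t ≤ B · x ^- ε = t ^ ↧ₙ ε * x ^ ∣ ↥ ε ∣ ≤ B ^ ↧ₙ ε

------------------------------------------------------------------------
-- Orthogonal vectors

⟨_∙_⟩ : ∀ {d} → Vec (Fin 2) d → Vec (Fin 2) d → ℕ
⟨ x ∙ y ⟩ = Vec.sum (Vec.zipWith (λ a b → toℕ a * toℕ b) x y)

record OVInstance : Set where
  field
    n d    : ℕ
    A      : Vec (Vec (Fin 2) d) n
    unique : Unique A

  Orthogonal : Set
  Orthogonal = ∃₂ λ x y → (x Vec.∈ A) × (y Vec.∈ A) × ⟨ x ∙ y ⟩ ≡ 0

  encoding : List ℕ
  encoding = n ∷ d ∷ concatMap (λ x → map toℕ (Vec.toList x)) (Vec.toList A)

OV : Problem
OV = record
  { Instance = OVInstance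
  ; size     = n
  ; input    = encoding
  ; Correct  = λ x out → (Orthogonal x → out 0 ≡ 1) × (¬ Orthogonal x → out 0 ≡ 0)
  }
  where open OVInstance

-- n ≥ 2 makes log n positive.
OVLog : ℕ → Problem
OVLog c = restrict OV λ x → let open OVInstance x in 2 ≤ n × d ≡ c * ⌈log₂ n ⌉

-- O(n ^ (2 - ε))
OVTime : ∀ c → ℚ → (Problem.Instance (OVLog c) → ℕ) → Set
OVTime c ε f = ∃₂ λ K n₀ → ∀ x → let open OVInstance (proj₁ x) in
  n₀ ≤ n → f x ≤ K * n ^ 2 · n ^- ε

OVConjecture : Set
OVConjecture = ∀ ε → 0ℚ <ℚ ε → ∃[ c ] 1 ≤ c × ¬ SolvableIn (OVLog c) (OVTime c ε)

------------------------------------------------------------------------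
-- Straight-line grammars

-- Nonterminals are Fin v; the letter k ∈ {1,…,σ} is the element of Fin σ
-- with toℕ equal to k - 1.
record SLG (σ : ℕ) : Set where
  field
    v     : ℕ
    start : Fin v
    rhs   : Fin v → List (Fin v ⊎ Fin σ)
    straightLine : Σ (Permutation′ v) λ N → ∀ i j →
      inj₁ (N ⟨$⟩ʳ j) ∈ rhs (N ⟨$⟩ʳ i) → i Fin.< j

  Symbol : Set
  Symbol = Fin v ⊎ Fin σ

  data _⟶_ : List Symbol → List Symbol → Set where
    rewrite-at : ∀ α X β → (α ++ inj₁ X ∷ β) ⟶ (α ++ rhs X ++ β)

  Generates : List (Fin σ) → Set
  Generates T = Star _⟶_ (inj₁ start ∷ []) (map inj₂ T)

  ∣G∣ : ℕ
  ∣G∣ = sum (map (λ X → length (rhs X) ⊔ 1) (allFin v))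

  encodeSymbol : Symbol → ℕ
  encodeSymbol (inj₁ X) = toℕ X
  encodeSymbol (inj₂ a) = v + toℕ a

  encodeRules : List ℕ
  encodeRules = concatMap (λ X → length (rhs X) ∷ map encodeSymbol (rhs X)) (allFin v)

------------------------------------------------------------------------
-- Batched range distinct count queries on a grammar-compressed string

-- |{T[i] : b < i ≤ e}|, with T indexed from 1.
distinct : ∀ {σ} → List (Fin σ) → ℕ → ℕ → ℕ
distinct T b e = length (deduplicate Fin._≟_ (take (e ∸ b) (drop b T)))

record RDCInstance : Set where
  field
    σ         : ℕ
    G         : SLG σ
    T         : List (Fin σ)
    generates : SLG.Generates G T

  open SLG G public

  N : ℕ
  N = length T

  field
    queries : List (Fin (suc N) × Fin (suc N))

  m : ℕ
  m = length queries

  -- The program is given G and the queries, but not T.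
  encoding : List ℕ
  encoding = v ∷ σ ∷ toℕ start ∷ m ∷ encodeRules ++
             concatMap (λ { (b , e) → toℕ b ∷ toℕ e ∷ [] }) queries

  answer : Fin m → ℕ
  answer i = distinct T (toℕ (proj₁ (lookup queries i))) (toℕ (proj₂ (lookup queries i)))

-- The size parameter covers everything that has to fit in a word: text
-- positions, letters, and addresses of the grammar and of the queries.
RDC : Problem
RDC = record
  { Instance = RDCInstance
  ; size     = λ x → N x + ∣G∣ x + m x + σ x
  ; input    = encoding
  ; Correct  = λ x out → ∀ i → out (toℕ i) ≡ answer x i
  }
  where open RDCInstance

-- For κ = a / b > 0, the conditions σ ≥ κ (N / log N) ^ (1/2) and
-- m ≥ κ |G| / log N with denominators cleared and the first one squared;
-- N ≥ 2 makes log N positive.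
Admissible : ℚ → RDCInstance → Set
Admissible κ x = 2 ≤ N
  × a ^ 2 * N ≤ b ^ 2 * (σ ^ 2 * ⌈log₂ N ⌉)
  × a * ∣G∣ ≤ b * (m * ⌈log₂ N ⌉)
  where
  open RDCInstance x
  a = ∣ ↥ κ ∣
  b = ↧ₙ κ

RDCLarge : ℚ → Problem
RDCLarge κ = restrict RDC (Admissible κ)

-- O(m |G| ^ (1 - ε) log ^ O(1) N)
RDCTime : ∀ κ → ℚ → (Problem.Instance (RDCLarge κ) → ℕ) → Set
RDCTime κ ε f = ∃[ c ] ∃[ K ] ∃[ N₀ ] ∀ x → let open RDCInstance (proj₁ x) in
  N₀ ≤ N → f x ≤ K * (m * ∣G∣ * ⌈log₂ N ⌉ ^ c) · ∣G∣ ^- ε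

{-# OPTIONS --safe #-}

-- Given vectors x₁, …, xₙ with d = c log n coordinates, use the letters 0, …, n.
-- Let Z be the word 0ⁿ, and let Sᵢ be the word of length n whose y-th letter is y if
-- x_y[i] = 1, and 0 otherwise.  The block of x is Z followed, for each coordinate i,
-- by Sᵢ if x[i] = 1 and by Z if x[i] = 0.  A letter y ≥ 1 occurs in it iff x and x_y
-- share a one, so x is orthogonal to some x_y iff its block has fewer than n + 1
-- distinct letters.  All blocks have length (d + 1) n; their concatenation has a grammar
-- of size 2 (d + 1) n, with one rule for the start symbol, one for Z and one for each Sᵢ,
-- and n queries suffice.  Unused letters and trivial queries bring σ and m up to 4 c a n,
-- which makes the instance admissible for κ = a / b.
--
-- On a word RAM the instance is written behind the input and then moved down to address
-- 0, so that the assumed program runs from a proper initial state; n survives the call in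
-- a register which that program does not mention.  If ε = p / q, the running time is
-- O(n ^ (2 - 1 / q)) up to powers of log n, hence O(n ^ (2 - 1 / (2 q))).

module Submission where

open import Defs
open import Data.Bool.Base using (true; false; if_then_else_; T)
open import Data.Fin.Base as Fin using (Fin; zero; suc; toℕ; fromℕ<; inject≤)
import Data.Fin.Properties as Fin
import Data.Fin.Permutation as Perm
open import Data.Integer.Base using (∣_∣)
open import Data.List.Base using (List; []; _∷_; _++_; map; concat; concatMap; length; lookup; take; drop; deduplicate; tabulate; replicate)
open import Data.List.Properties
open import Data.List.Membership.Propositional using (_∈_)
open import Data.List.Membership.Propositional.Properties using (∈-map⁺; ∈-map⁻; ∈-++⁺ˡ; ∈-++⁺ʳ; ∈-++⁻; ∈-∃++; ∈-tabulate⁺; ∈-tabulate⁻; ∈-concat⁺′; ∈-concat⁻′; ∈-deduplicate⁺; ∈-deduplicate⁻)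
open import Data.List.Relation.Unary.All as All using (All; []; _∷_)
import Data.List.Relation.Unary.All.Properties as All
open import Data.List.Relation.Unary.Unique.Propositional as Unique using (Unique; []; _∷_)
import Data.List.Relation.Unary.Unique.Propositional.Properties as Unique
open import Data.List.Relation.Unary.Unique.DecPropositional.Properties using (deduplicate-!)
open import Data.List.Relation.Unary.Any using (here; there)
open import Data.Nat.Base
open import Data.Nat.Coprimality using (1-coprimeTo)
open import Data.Nat.DivMod
open import Data.Nat.Induction using (<-rec)
open import Data.Nat.ListAction using (sum)
open import Data.Nat.Logarithm using (⌈log₂_⌉; ⌈log₂⌉-mono-≤; ⌈log₂2^n⌉≡n; ⌈log₂⌈n/2⌉⌉≡⌈log₂n⌉∸1)
open import Data.Nat.Properties
open import Data.Nat.Tactic.RingSolver using (solve-∀)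
open import Data.Product.Base using (∃₂; ∃-syntax; _×_; _,_; proj₁; proj₂)
import Data.Rational.Base as ℚ
import Data.Integer.Base as ℤ
open import Data.Rational.Base using (ℚ; 0ℚ; ↥_; ↧ₙ_) renaming (_<_ to _<ℚ_)
open import Data.Sum.Base using (_⊎_; inj₁; inj₂)
open import Data.Vec.Base as Vec using (Vec)
import Data.Vec.Properties as Vec
import Data.Vec.Membership.Propositional.Properties as Vec
import Data.Vec.Relation.Unary.Any as Vec using (index)
import Data.Vec.Relation.Unary.Any.Properties as Vec using (lookup-index)
open import Function.Base using (_∘_; id; _$_)
open import Relation.Binary.PropositionalEquality
open import Relation.Binary.Construct.Closure.ReflexiveTransitive using (Star; _◅_) renaming (ε to stop)
open import Relation.Binary.Definitions using (Tri; tri<; tri≈; tri>)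
open import Relation.Nullary.Decidable.Core using (yes; no)
open import Relation.Nullary.Negation.Core using (¬_; contradiction)

-- Word arithmetic, lists as memory and Hoare triples

-- For fixed c and κ the instance sits at both thresholds: N is of order n² log n and σ of order n,
-- so σ is of order (N / log N)^(1/2); |G| is of order n log n and m of order n, so m is of order
-- |G| / log N. Hence m |G|^(1 - ε) is n^(2 - ε) up to logarithms, and compression is what keeps
-- writing the instance far below n².
--
-- The conjecture reveals c only after the exponent is chosen, so the exponent may depend on ε
-- alone, while c and κ are paid for by constants in σ, m and the word length. The logarithm of the
-- new size lies between log n and a constant times log n, which keeps the word lengths of the two
-- problems compatible.
--
-- The assumed program is known only on zero registers and an exact memory image of the encoding.
-- This forces bounds on every number written, erasure of the leftovers, and an argument that a
-- register holding n does not disturb the call.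

n<2^n : ∀ n → n < 2 ^ n
n<2^n zero    = s≤s z≤n
n<2^n (suc n) = begin-strict
  1 + n              <⟨ +-mono-≤-< (m^n>0 2 n) (n<2^n n) ⟩
  2 ^ n + 2 ^ n      ≡⟨ cong (2 ^ n +_) (sym (+-identityʳ (2 ^ n))) ⟩
  2 ^ suc n          ∎
  where open ≤-Reasoning

module _ (w : ℕ) where

  private instance
    2^w≢0 : NonZero (2 ^ w)
    2^w≢0 = m^n≢0 2 w

  reduce-< : ∀ {a} → a < 2 ^ w → reduce w a ≡ a
  reduce-< = m<n⇒m%n≡m

  reduce-zero : reduce w 0 ≡ 0
  reduce-zero = reduce-< (m^n>0 2 w)

  reduce-reduce : ∀ a → reduce w (reduce w a) ≡ reduce w a
  reduce-reduce a = m%n%n≡m%n a (2 ^ w)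

  add-reduce : ∀ a b → ⟦ add ⟧ w (reduce w a) (reduce w b) ≡ reduce w (a + b)
  add-reduce a b = sym (%-distribˡ-+ a b (2 ^ w))

  mul-reduce : ∀ a b → ⟦ mul ⟧ w (reduce w a) (reduce w b) ≡ reduce w (a * b)
  mul-reduce a b = sym (%-distribˡ-* a b (2 ^ w))

  reduce-+ˡ : ∀ a b → reduce w (reduce w a + b) ≡ reduce w (a + b)
  reduce-+ˡ a b = begin
    reduce w (reduce w a + b)                       ≡⟨ %-distribˡ-+ (reduce w a) b (2 ^ w) ⟩
    reduce w (reduce w (reduce w a) + reduce w b)   ≡⟨ cong (λ z → reduce w (z + reduce w b)) (reduce-reduce a) ⟩
    reduce w (reduce w a + reduce w b)              ≡⟨ add-reduce a b ⟩
    reduce w (a + b)                                ∎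
    where open ≡-Reasoning

  -- Splitting `b` into its residue and a multiple of W = `2 ^ w` turns `a + (W ∸ b′)` into `a ∸ b`
  -- plus `suc (b / W)` copies of W; `b ≤ a` keeps the truncated difference a true one.
  sub-reduce : ∀ a b → b ≤ a → ⟦ sub ⟧ w (reduce w a) (reduce w b) ≡ reduce w (a ∸ b)
  sub-reduce a b b≤a = begin
    reduce w (reduce w a + (W ∸ b′))   ≡⟨ reduce-+ˡ a _ ⟩
    reduce w (a + (W ∸ b′))            ≡⟨ cong (reduce w) shifted ⟩
    reduce w (a ∸ b + suc (b / W) * W) ≡⟨ [m+kn]%n≡m%n (a ∸ b) (suc (b / W)) W ⟩
    reduce w (a ∸ b)                   ∎
    where
    open ≡-Reasoning
    W = 2 ^ w
    b′ = reduce w b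
    rearrange : ∀ c r s t → c + (r + s) + t ≡ c + (r + t + s)
    rearrange = solve-∀
    shifted : a + (W ∸ b′) ≡ a ∸ b + suc (b / W) * W
    shifted = begin
      a + (W ∸ b′)                       ≡⟨ cong (_+ (W ∸ b′)) (m∸n+n≡m b≤a) ⟨
      a ∸ b + b + (W ∸ b′)               ≡⟨ cong (λ z → a ∸ b + z + (W ∸ b′)) (m≡m%n+[m/n]*n b W) ⟩
      a ∸ b + (b′ + b / W * W) + (W ∸ b′) ≡⟨ rearrange (a ∸ b) b′ (b / W * W) (W ∸ b′) ⟩
      a ∸ b + (b′ + (W ∸ b′) + b / W * W) ≡⟨ cong (λ z → a ∸ b + (z + b / W * W)) (m+[n∸m]≡n (<⇒≤ (m%n<n b W))) ⟩
      a ∸ b + (W + b / W * W)            ∎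

  -- Comparison does not respect congruence modulo `2 ^ w`, so unlike the arithmetic operations it
  -- needs operands that fit in a word.
  lt-reduce : ∀ a b → a < 2 ^ w → b < 2 ^ w →
              ⟦ lt ⟧ w (reduce w a) (reduce w b) ≡ reduce w (fromBool (a <ᵇ b))
  lt-reduce a b a< b< = cong₂ (λ x y → reduce w (fromBool (x <ᵇ y))) (reduce-< a<) (reduce-< b<)

-- Pads with zeros, matching the default of `cell`. At literal indices it computes, so most register
-- states in the program proofs agree by `refl`.
set : List ℕ → ℕ → ℕ → List ℕ
set []       zero    v = v ∷ []
set []       (suc i) v = 0 ∷ set [] i v
set (x ∷ xs) zero    v = v ∷ xs
set (x ∷ xs) (suc i) v = x ∷ set xs i v

cell-set : ∀ xs i v j → cell (set xs i v) j ≡ (cell xs [ i ↦ v ]) j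
cell-set []       zero    v zero    = refl
cell-set []       zero    v (suc j) = refl
cell-set []       (suc i) v zero    = refl
cell-set []       (suc i) v (suc j) = cell-set [] i v j
cell-set (x ∷ xs) zero    v zero    = refl
cell-set (x ∷ xs) zero    v (suc j) = refl
cell-set (x ∷ xs) (suc i) v zero    = refl
cell-set (x ∷ xs) (suc i) v (suc j) = cell-set xs i v j

set-∷ʳ : ∀ xs v → set xs (length xs) v ≡ xs ++ v ∷ []
set-∷ʳ []       v = refl
set-∷ʳ (x ∷ xs) v = cong (x ∷_) (set-∷ʳ xs v)

cell-++ˡ : ∀ xs ys i → i < length xs → cell (xs ++ ys) i ≡ cell xs i
cell-++ˡ (x ∷ xs) ys zero    _         = refl
cell-++ˡ (x ∷ xs) ys (suc i) (s≤s i<) = cell-++ˡ xs ys i i<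

cell-++ʳ : ∀ xs ys i → cell (xs ++ ys) (length xs + i) ≡ cell ys i
cell-++ʳ []       ys i = refl
cell-++ʳ (x ∷ xs) ys i = cell-++ʳ xs ys i

cell-replicate : ∀ n i → cell (replicate n 0) i ≡ 0
cell-replicate zero    i       = refl
cell-replicate (suc n) zero    = refl
cell-replicate (suc n) (suc i) = cell-replicate n i

cell-++-replicate : ∀ xs n i → cell (xs ++ replicate n 0) i ≡ cell xs i
cell-++-replicate []       n i       = cell-replicate n i
cell-++-replicate (x ∷ xs) n zero    = refl
cell-++-replicate (x ∷ xs) n (suc i) = cell-++-replicate xs n i

cell-map-reduce : ∀ w xs i → cell (map (reduce w) xs) i ≡ reduce w (cell xs i)
cell-map-reduce w []       i       = sym (reduce-zero w)
cell-map-reduce w (x ∷ xs) zero    = refl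
cell-map-reduce w (x ∷ xs) (suc i) = cell-map-reduce w xs i

cell-past-end : ∀ xs {i} → length xs ≤ i → cell xs i ≡ 0
cell-past-end []       _              = refl
cell-past-end (x ∷ xs) (s≤s ≤i) = cell-past-end xs ≤i

infix 3 _∣_

record Assertion : Set where
  constructor _∣_
  field
    regs   : List ℕ
    memory : ℕ → ℕ

open Assertion

-- Registers are specified modulo 2 ^ w, so that arithmetic has no overflow side
-- conditions; memory is specified exactly.
_[_]⊨_ : State → ℕ → Assertion → Set
s [ w ]⊨ (ρ ∣ M) = (∀ r → reg s r ≡ reduce w (cell ρ r)) × (∀ i → mem s i ≡ M i)

record Triple (w : ℕ) (α : Assertion) (p : Program) (β : Assertion) (T : ℕ) : Set where
  constructor triple
  field
    run : ∀ s → s [ w ]⊨ α → ∃₂ λ t s′ → (w ⊢ p , s ⇓[ t ] s′) × t ≤ T × s′ [ w ]⊨ β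

open Triple

module _ {w : ℕ} where

  update-⊨ : ∀ {f : ℕ → ℕ} ρ {v v′} r → (∀ i → f i ≡ reduce w (cell ρ i)) → v ≡ reduce w v′ →
             ∀ i → (f [ r ↦ v ]) i ≡ reduce w (cell (set ρ r v′) i)
  update-⊨ ρ {v′ = v′} r f≗ v≡ i rewrite cell-set ρ r v′ i with i ≡ᵇ r
  ... | true  = v≡
  ... | false = f≗ i

  conseq : ∀ {α α′ β β′ p T T′} → α ≡ α′ → β′ ≡ β → T′ ≤ T → Triple w α′ p β′ T′ → Triple w α p β T
  conseq refl refl T′≤T tr .run s s⊨ with tr .run s s⊨
  ... | t , s′ , p⇓ , t≤ , s′⊨ = t , s′ , p⇓ , ≤-trans t≤ T′≤T , s′⊨

  weaken-memory : ∀ {α ρ M M′ p T} → (∀ i → M i ≡ M′ i) → Triple w α p (ρ ∣ M) T → Triple w α p (ρ ∣ M′) T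
  weaken-memory M≗ tr .run s s⊨ with tr .run s s⊨
  ... | t , s′ , p⇓ , t≤ , (rs , ms) = t , s′ , p⇓ , t≤ , (rs , λ i → trans (ms i) (M≗ i))

  infixr 5 _⨟_

  _⨟_ : ∀ {α β γ p q T U} → Triple w α p β T → Triple w β q γ U → Triple w α (p ⨾ q) γ (T + U)
  (P ⨟ Q) .run s s⊨ with P .run s s⊨
  ... | t , s′ , p⇓ , t≤ , s′⊨ with Q .run s′ s′⊨
  ... | u , s″ , q⇓ , u≤ , s″⊨ = t + u , s″ , seq⇓ p⇓ q⇓ , +-mono-≤ t≤ u≤ , s″⊨

  constᵗ : ∀ {ρ M} r k → Triple w (ρ ∣ M) (const r k) (set ρ r k ∣ M) 1
  constᵗ {ρ} r k .run s (rs , ms) = _ , _ , const⇓ , ≤-refl , (update-⊨ ρ r rs refl , ms)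

  opᵗ : ∀ {ρ M} o r a b {v} → ⟦ o ⟧ w (reduce w (cell ρ a)) (reduce w (cell ρ b)) ≡ reduce w v →
        Triple w (ρ ∣ M) (op o r a b) (set ρ r v ∣ M) 1
  opᵗ {ρ} o r a b v≡ .run s (rs , ms) =
    _ , _ , op⇓ , ≤-refl , (update-⊨ ρ r rs (trans (cong₂ (⟦ o ⟧ w) (rs a) (rs b)) v≡) , ms)

  addᵗ : ∀ {ρ M} r a b → Triple w (ρ ∣ M) (op add r a b) (set ρ r (cell ρ a + cell ρ b) ∣ M) 1
  addᵗ {ρ} r a b = opᵗ add r a b (add-reduce w (cell ρ a) (cell ρ b))

  mulᵗ : ∀ {ρ M} r a b → Triple w (ρ ∣ M) (op mul r a b) (set ρ r (cell ρ a * cell ρ b) ∣ M) 1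
  mulᵗ {ρ} r a b = opᵗ mul r a b (mul-reduce w (cell ρ a) (cell ρ b))

  subᵗ : ∀ {ρ M} r a b → cell ρ b ≤ cell ρ a →
         Triple w (ρ ∣ M) (op sub r a b) (set ρ r (cell ρ a ∸ cell ρ b) ∣ M) 1
  subᵗ {ρ} r a b b≤a = opᵗ sub r a b (sub-reduce w (cell ρ a) (cell ρ b) b≤a)

  ltᵗ : ∀ {ρ M} r a b → cell ρ a < 2 ^ w → cell ρ b < 2 ^ w →
        Triple w (ρ ∣ M) (op lt r a b) (set ρ r (fromBool (cell ρ a <ᵇ cell ρ b)) ∣ M) 1
  ltᵗ {ρ} r a b a< b< = opᵗ lt r a b (lt-reduce w (cell ρ a) (cell ρ b) a< b<)

  loadᵗ : ∀ {ρ M} r a v → cell ρ a < 2 ^ w → M (cell ρ a) ≡ reduce w v →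
          Triple w (ρ ∣ M) (load r a) (set ρ r v ∣ M) 1
  loadᵗ {ρ} r a v a< v≡ .run s (rs , ms) =
    _ , _ , load⇓ , ≤-refl ,
    (update-⊨ ρ r rs (trans (cong (mem s) (trans (rs a) (reduce-< w a<))) (trans (ms _) v≡)) , ms)

  storeᵗ : ∀ {ρ M} a r → cell ρ a < 2 ^ w →
           Triple w (ρ ∣ M) (store a r) (ρ ∣ (M [ cell ρ a ↦ reduce w (cell ρ r) ])) 1
  storeᵗ {ρ} {M} a r a< .run s (rs , ms) = _ , _ , store⇓ , ≤-refl , (rs , upd)
    where
    upd : ∀ i → (mem s [ reg s a ↦ reg s r ]) i ≡ (M [ cell ρ a ↦ reduce w (cell ρ r) ]) i
    upd i rewrite rs a | reduce-< w a< with i ≡ᵇ cell ρ a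
    ... | true  = rs r
    ... | false = ms i

  while-done : ∀ {ρ M r p} → cell ρ r ≡ 0 → Triple w (ρ ∣ M) (while r p) (ρ ∣ M) 1
  while-done r≡0 .run s (rs , ms) =
    _ , _ , done⇓ (trans (rs _) (trans (cong (reduce w) r≡0) (reduce-zero w))) , ≤-refl , (rs , ms)

  while-step : ∀ {α β γ r p T U n} → suc n < 2 ^ w → cell (regs α) r ≡ suc n →
               Triple w α p β T → Triple w β (while r p) γ U →
               Triple w α (while r p) γ (suc (T + U))
  while-step {r = r} n< test P Q .run s s⊨ with P .run s s⊨
  ... | t , s′ , p⇓ , t≤ , s′⊨ with Q .run s′ s′⊨
  ... | u , s″ , q⇓ , u≤ , s″⊨ = _ , s″ , while⇓ r≢0 p⇓ q⇓ , s≤s (+-mono-≤ t≤ u≤) , s″⊨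
    where
    r≢0 : reg s r ≢ 0
    r≢0 r≡0 = 1+n≢0 (trans (sym (trans (proj₁ s⊨ r) (trans (cong (reduce w) test) (reduce-< w n<)))) r≡0)

  -- Registers are known only modulo `2 ^ w`; `n < 2 ^ w` prevents a positive count from looking
  -- like 0. Each pass costs its body and one test, and one more test ends the loop.
  whileᵗ : ∀ n (α : ℕ → Assertion) {r p T} → n < 2 ^ w →
           (∀ i → cell (regs (α i)) r ≡ n ∸ i) →
           (∀ (i : Fin n) → Triple w (α (toℕ i)) p (α (suc (toℕ i))) T) →
           Triple w (α 0) (while r p) (α n) (suc (n * suc T))
  whileᵗ zero    α n< test body = while-done (test 0)
  whileᵗ (suc n) α {T = T} n< test body =
    conseq refl refl (s≤s (≤-reflexive (+-suc T (n * suc T)))) $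
    while-step n< (test 0) (body zero)
      (whileᵗ n (α ∘ suc) (<-trans ≤-refl n<) (test ∘ suc) (body ∘ suc))

words : ℕ → List ℕ → ℕ → ℕ
words w ys = cell (map (reduce w) ys)

words-set : ∀ w ys i v j → (words w ys [ i ↦ reduce w v ]) j ≡ words w (set ys i v) j
words-set w ys i v j rewrite cell-map-reduce w (set ys i v) j | cell-set ys i v j with j ≡ᵇ i
... | true  = refl
... | false = cell-map-reduce w ys j

-- Registers a program does not mention

registers : Program → ℕ
registers skip         = 0
registers (const r k)  = suc r
registers (op o r a b) = suc r ⊔ (suc a ⊔ suc b)
registers (load r a)   = suc r ⊔ suc a
registers (store a r)  = suc a ⊔ suc r
registers (p ⨾ q)      = registers p ⊔ registers q
registers (ifnz r p q) = suc r ⊔ (registers p ⊔ registers q)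
registers (while r p)  = suc r ⊔ registers p

update-agree : ∀ {f g : ℕ → ℕ} {K v v′} r → (∀ i → i < K → f i ≡ g i) → v ≡ v′ →
               ∀ i → i < K → (f [ r ↦ v ]) i ≡ (g [ r ↦ v′ ]) i
update-agree r f≗g v≡ i i< with i ≡ᵇ r
... | true  = v≡
... | false = f≗g i i<

update-other : ∀ (f : ℕ → ℕ) {r v} i → i ≢ r → (f [ r ↦ v ]) i ≡ f i
update-other f {r} i i≢r with i ≡ᵇ r in i≡ᵇr
... | true  = contradiction (≡ᵇ⇒≡ i r (subst T (sym i≡ᵇr) _)) i≢r
... | false = refl

-- `SolvableIn` promises runs only from registers that are all 0, while in the reduction one
-- register holds n. Induction on the derivation replays the run on the changed registers, with the
-- same time and memory.
frame : ∀ {w p s s′ t K} → w ⊢ p , s ⇓[ t ] s′ → registers p ≤ K →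
        ∀ f → (∀ r → r < K → f r ≡ reg s r) →
        ∃[ f′ ] (w ⊢ p , ⟨ f , mem s ⟩ ⇓[ t ] ⟨ f′ , mem s′ ⟩)
          × (∀ r → r < K → f′ r ≡ reg s′ r) × (∀ r → K ≤ r → f′ r ≡ f r)
frame skip⇓ _ f f≗ = f , skip⇓ , f≗ , λ _ _ → refl
frame const⇓ r< f f≗ =
  _ , const⇓ , update-agree _ f≗ refl , λ i K≤ → update-other f i (>⇒≢ (<-≤-trans r< K≤))
frame {w} (op⇓ {o = o} {r} {a} {b}) ≤K f f≗ =
  _ , op⇓ , update-agree _ f≗ (cong₂ (⟦ o ⟧ w) (f≗ a a<) (f≗ b b<)) ,
  λ i K≤ → update-other f i (>⇒≢ (<-≤-trans (m⊔n≤o⇒m≤o (suc r) (suc a ⊔ suc b) ≤K) K≤))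
  where
  a< = m⊔n≤o⇒m≤o (suc a) (suc b) (m⊔n≤o⇒n≤o (suc r) (suc a ⊔ suc b) ≤K)
  b< = m⊔n≤o⇒n≤o (suc a) (suc b) (m⊔n≤o⇒n≤o (suc r) (suc a ⊔ suc b) ≤K)
frame {s = s} (load⇓ {r = r} {a}) ≤K f f≗ =
  _ , load⇓ , update-agree _ f≗ (cong (mem s) (f≗ a (m⊔n≤o⇒n≤o (suc r) (suc a) ≤K))) ,
  λ i K≤ → update-other f i (>⇒≢ (<-≤-trans (m⊔n≤o⇒m≤o (suc r) (suc a) ≤K) K≤))
frame {w} {s = s} (store⇓ {a = a} {r}) ≤K f f≗ =
  f , subst₂ (λ x y → w ⊢ store a r , ⟨ f , mem s ⟩ ⇓[ 1 ] ⟨ f , mem s [ x ↦ y ] ⟩)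
        (f≗ a (m⊔n≤o⇒m≤o (suc a) (suc r) ≤K)) (f≗ r (m⊔n≤o⇒n≤o (suc a) (suc r) ≤K)) store⇓ ,
  f≗ , λ _ _ → refl
frame (seq⇓ {p} {q} p⇓ q⇓) ≤K f f≗ =
  let g , p⇓′ , g≗ , g≡f = frame p⇓ (m⊔n≤o⇒m≤o (registers p) _ ≤K) f f≗
      h , q⇓′ , h≗ , h≡g = frame q⇓ (m⊔n≤o⇒n≤o (registers p) _ ≤K) g g≗
  in h , seq⇓ p⇓′ q⇓′ , h≗ , λ r K≤ → trans (h≡g r K≤) (g≡f r K≤)
frame (ifnz⇓ {r} {p} {q} r≢0 p⇓) ≤K f f≗ =
  let g , p⇓′ , rest = frame p⇓ (m⊔n≤o⇒m≤o (registers p) _ (m⊔n≤o⇒n≤o (suc r) (registers p ⊔ registers q) ≤K)) f f≗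
  in g , ifnz⇓ (r≢0 ∘ trans (sym (f≗ r (m⊔n≤o⇒m≤o (suc r) (registers p ⊔ registers q) ≤K)))) p⇓′ , rest
frame (ifz⇓ {r} {p} {q} r≡0 q⇓) ≤K f f≗ =
  let g , q⇓′ , rest = frame q⇓ (m⊔n≤o⇒n≤o (registers p) _ (m⊔n≤o⇒n≤o (suc r) (registers p ⊔ registers q) ≤K)) f f≗
  in g , ifz⇓ (trans (f≗ r (m⊔n≤o⇒m≤o (suc r) (registers p ⊔ registers q) ≤K)) r≡0) q⇓′ , rest
frame (while⇓ {r} {p} r≢0 p⇓ q⇓) ≤K f f≗ =
  let g , p⇓′ , g≗ , g≡f = frame p⇓ (m⊔n≤o⇒n≤o (suc r) (registers p) ≤K) f f≗
      h , q⇓′ , h≗ , h≡g = frame q⇓ ≤K g g≗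
  in h , while⇓ (r≢0 ∘ trans (sym (f≗ r (m⊔n≤o⇒m≤o (suc r) (registers p) ≤K)))) p⇓′ q⇓′ , h≗ ,
     λ i K≤ → trans (h≡g i K≤) (g≡f i K≤)
frame (done⇓ {r} {p} r≡0) ≤K f f≗ =
  f , done⇓ (trans (f≗ r (m⊔n≤o⇒m≤o (suc r) (registers p) ≤K)) r≡0) , f≗ , λ _ _ → refl

-- Programs that append to memory

emit : ℕ → Program
emit r = store 3 r ⨾ op add 3 0 3

module Emission (w : ℕ) (inp : List ℕ) where

  end : List ℕ → ℕ
  end zs = length (inp ++ zs)

  -- Register 3 points behind the memory in use, so the registers are a function of that address.
  at : (ℕ → List ℕ) → List ℕ → Assertion
  at ρ zs = ρ (end zs) ∣ words w (inp ++ zs)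

  -- Quantifying over everything written before lets fragments compose by concatenating their
  -- outputs. The room is measured after the emission, so every address written to is a word.
  record Emits (ρ : ℕ → List ℕ) (p : Program) (ρ′ : ℕ → List ℕ) (g : List ℕ) (T : ℕ) : Set where
    constructor emits
    field
      emission : ∀ zs → end (zs ++ g) ≤ 2 ^ w → Triple w (at ρ zs) p (at ρ′ (zs ++ g)) T

  open Emits public

  silent : ∀ {ρ ρ′ p T} →
           (∀ zs → end zs ≤ 2 ^ w → Triple w (at ρ zs) p (at ρ′ zs) T) → Emits ρ p ρ′ [] T
  silent {ρ} {ρ′} {p} {T} tr .emission zs room =
    subst (λ ys → Triple w (at ρ zs) p (at ρ′ ys) T) (sym (++-identityʳ zs))
      (tr zs (subst (λ ys → end ys ≤ 2 ^ w) (++-identityʳ zs) room))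

  end-++ : ∀ zs g → end zs ≤ end (zs ++ g)
  end-++ zs g = ≤-trans (m≤m+n (end zs) (length g)) (≤-reflexive
    (trans (sym (length-++ (inp ++ zs))) (cong length (++-assoc inp zs g))))

  infixr 5 _⨟ᵉ_ _⨟∅_

  _⨟ᵉ_ : ∀ {ρ ρ′ ρ″ p q g h T U} →
         Emits ρ p ρ′ g T → Emits ρ′ q ρ″ h U → Emits ρ (p ⨾ q) ρ″ (g ++ h) (T + U)
  _⨟ᵉ_ {ρ} {ρ′} {ρ″} {p} {q} {g} {h} {T} {U} P Q .emission zs room =
    P .emission zs (≤-trans (end-++ (zs ++ g) h) room′)
    ⨟ subst (λ ys → Triple w (at ρ′ (zs ++ g)) q (at ρ″ ys) U) (++-assoc zs g h)
        (Q .emission (zs ++ g) room′)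
    where
    room′ : end ((zs ++ g) ++ h) ≤ 2 ^ w
    room′ = subst (λ ys → end ys ≤ 2 ^ w) (sym (++-assoc zs g h)) room

  -- Avoids the trailing `++ []` after a silent fragment, which does not reduce, whereas a leading
  -- `[] ++` does.
  _⨟∅_ : ∀ {ρ ρ′ ρ″ p q g T U} →
         Emits ρ p ρ′ g T → Emits ρ′ q ρ″ [] U → Emits ρ (p ⨾ q) ρ″ g (T + U)
  _⨟∅_ {ρ} {ρ″ = ρ″} {p} {q} {g} {T} {U} P Q =
    subst (λ h → Emits ρ (p ⨾ q) ρ″ h (T + U)) (++-identityʳ g) (P ⨟ᵉ Q)

  constᵉ : ∀ {ρ} r k → Emits ρ (const r k) (λ P → set (ρ P) r k) [] 1
  constᵉ r k = silent λ _ _ → constᵗ r k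

  addᵉ : ∀ {ρ} r a b → Emits ρ (op add r a b) (λ P → set (ρ P) r (cell (ρ P) a + cell (ρ P) b)) [] 1
  addᵉ r a b = silent λ _ _ → addᵗ r a b

  mulᵉ : ∀ {ρ} r a b → Emits ρ (op mul r a b) (λ P → set (ρ P) r (cell (ρ P) a * cell (ρ P) b)) [] 1
  mulᵉ r a b = silent λ _ _ → mulᵗ r a b

  subᵉ : ∀ {ρ} r a b → (∀ P → cell (ρ P) b ≤ cell (ρ P) a) →
         Emits ρ (op sub r a b) (λ P → set (ρ P) r (cell (ρ P) a ∸ cell (ρ P) b)) [] 1
  subᵉ r a b b≤a = silent λ _ _ → subᵗ r a b (b≤a _)

  -- Output is written behind `inp`, so input cells can be read at any time during the writing.
  loadᵉ : ∀ {ρ} r a x v → (∀ P → cell (ρ P) a ≡ x) → x < length inp → cell inp x ≡ v →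
          Emits ρ (load r a) (λ P → set (ρ P) r v) [] 1
  loadᵉ {ρ} r a x v a≡ x< x↦v = silent λ zs room → loadᵗ r a v
    (<-≤-trans (subst (_< end zs) (sym (a≡ _)) (<-≤-trans x< (length-++-≤ˡ inp))) room)
    (begin
      words w (inp ++ zs) (cell (ρ (end zs)) a) ≡⟨ cong (words w (inp ++ zs)) (a≡ _) ⟩
      words w (inp ++ zs) x                     ≡⟨ cell-map-reduce w (inp ++ zs) x ⟩
      reduce w (cell (inp ++ zs) x)             ≡⟨ cong (reduce w) (cell-++ˡ inp zs x x<) ⟩
      reduce w (cell inp x)                     ≡⟨ cong (reduce w) x↦v ⟩
      reduce w v                                ∎)
    where open ≡-Reasoning

  -- The last hypothesis says that `ρ P` depends on `P` only through register 3; hence advancing the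
  -- pointer gives `ρ` at the new end.
  emitᵉ : ∀ {ρ} r v → (∀ P → cell (ρ P) 3 ≡ P) → (∀ P → cell (ρ P) 0 ≡ 1) →
          (∀ P → cell (ρ P) r ≡ v) → (∀ P Q → set (ρ P) 3 Q ≡ ρ Q) →
          Emits ρ (emit r) ρ (v ∷ []) 2
  emitᵉ {ρ} r v ptr one val stable .emission zs room =
    conseq refl (cong (_∣ words w (inp ++ zs ++ v ∷ [])) regs≡) ≤-refl
      (weaken-memory memory≗ (storeᵗ 3 r (subst (_< 2 ^ w) (sym (ptr _)) end<)) ⨟ addᵗ 3 0 3)
    where
    zs+v : end (zs ++ v ∷ []) ≡ suc (end zs)
    zs+v = trans (cong length (sym (++-assoc inp zs (v ∷ []))))
             (trans (length-++ (inp ++ zs)) (+-comm _ 1))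
    end< : end zs < 2 ^ w
    end< = subst (_≤ 2 ^ w) zs+v room
    memory≗ : ∀ i → (words w (inp ++ zs) [ cell (ρ (end zs)) 3 ↦ reduce w (cell (ρ (end zs)) r) ]) i
                    ≡ words w (inp ++ zs ++ v ∷ []) i
    memory≗ i rewrite ptr (end zs) | val (end zs) = trans (words-set w (inp ++ zs) (end zs) v i)
      (cong (λ ys → words w ys i) (trans (set-∷ʳ (inp ++ zs) v) (++-assoc inp zs (v ∷ []))))
    regs≡ : set (ρ (end zs)) 3 (cell (ρ (end zs)) 0 + cell (ρ (end zs)) 3) ≡ ρ (end (zs ++ v ∷ []))
    regs≡ rewrite one (end zs) | ptr (end zs) | zs+v = stable (end zs) (suc (end zs))

  whileᵉ : ∀ n (ρ : ℕ → ℕ → List ℕ) (g : Fin n → List ℕ) {r p T} → n < 2 ^ w →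
           (∀ i P → cell (ρ i P) r ≡ n ∸ i) →
           (∀ i → Emits (ρ (toℕ i)) p (ρ (suc (toℕ i))) (g i) T) →
           Emits (ρ 0) (while r p) (ρ n) (concat (tabulate g)) (suc (n * suc T))
  whileᵉ zero    ρ g n< test body = silent λ _ _ → while-done (test 0 _)
  whileᵉ (suc n) ρ g {r} {p} {T} n< test body .emission zs room =
    conseq refl refl (s≤s (≤-reflexive (+-suc T (n * suc T)))) $
    while-step n< (test 0 _) (body zero .emission zs (≤-trans (end-++ (zs ++ g zero) gs) room′)) $
    subst (λ ys → Triple w (at (ρ 1) (zs ++ g zero)) (while r p) (at (ρ (suc n)) ys) (suc (n * suc T)))
      (++-assoc zs (g zero) gs)
      (whileᵉ n (ρ ∘ suc) (g ∘ suc) (<-trans ≤-refl n<) (test ∘ suc) (body ∘ suc) .emission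
        (zs ++ g zero) room′)
    where
    gs = concat (tabulate (g ∘ suc))
    room′ : end ((zs ++ g zero) ++ gs) ≤ 2 ^ w
    room′ = subst (λ ys → end ys ≤ 2 ^ w) (sym (++-assoc zs (g zero) gs)) room

-- Writing the instance

-- The two cells for n and d precede the rows, hence the two increments. Resetting register 5
-- restores the shape of the loop invariants.
loadBit : (row col : ℕ) → Program
loadBit row col =
  op mul 5 row 2 ⨾ op add 5 5 col ⨾ op add 5 0 5 ⨾ op add 5 0 5 ⨾ load 10 5 ⨾ const 5 0

-- Registers: 0 the constant 1, 1 n, 2 d, 3 the output address, 4 k n, 5 an
-- input address, 6 and 8 loop counters, 7 and 9 the iterations left,
-- 10 scratch, 11 d + 1, 12 the block length (d + 1) n, 13 the constant 0,
-- 14 the number d + 2 of nonterminals.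
setup : ℕ → Program
setup k =
  const 0 1 ⨾ load 1 10 ⨾ load 2 0 ⨾ const 4 k ⨾ op mul 4 4 1 ⨾ op add 11 0 2 ⨾ op mul 12 11 1 ⨾
  op add 14 0 11 ⨾ const 13 0 ⨾ op mul 3 1 2 ⨾ op add 3 0 3 ⨾ op add 3 0 3

-- These are v, σ, the start symbol and m; σ and m share register 4 because the padding makes them
-- equal.
writeHeader : Program
writeHeader = emit 14 ⨾ emit 4 ⨾ emit 13 ⨾ emit 4

writeStartRow : Program
writeStartRow = op sub 9 2 8 ⨾ while 9
  (loadBit 6 8 ⨾ op add 8 0 8 ⨾ op mul 10 10 8 ⨾ op add 10 0 10 ⨾ emit 10 ⨾ const 10 0 ⨾ op sub 9 2 8)
  ⨾ const 8 0 ⨾ const 9 0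

writeStartRule : Program
writeStartRule = emit 12 ⨾ op sub 7 1 6 ⨾ while 7
  (emit 0 ⨾ writeStartRow ⨾ op add 6 0 6 ⨾ op sub 7 1 6)
  ⨾ const 6 0 ⨾ const 7 0

writeDummyRule : Program
writeDummyRule = emit 1 ⨾ op sub 9 1 8 ⨾ while 9 (emit 14 ⨾ op add 8 0 8 ⨾ op sub 9 1 8)
  ⨾ const 8 0 ⨾ const 9 0

writeColumn : Program
writeColumn = op sub 9 1 8 ⨾ while 9
  (loadBit 8 6 ⨾ op add 8 0 8 ⨾ op mul 10 10 8 ⨾ op add 10 14 10 ⨾ emit 10 ⨾ const 10 0 ⨾ op sub 9 1 8)
  ⨾ const 8 0 ⨾ const 9 0

writeColumnRules : Program
writeColumnRules = op sub 7 2 6 ⨾ while 7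
  (emit 1 ⨾ writeColumn ⨾ op add 6 0 6 ⨾ op sub 7 2 6)
  ⨾ const 6 0 ⨾ const 7 0

writeQueries : Program
writeQueries = op sub 7 1 6 ⨾ while 7
  (op mul 10 6 12 ⨾ emit 10 ⨾ op add 10 12 10 ⨾ emit 10 ⨾ const 10 0 ⨾ op add 6 0 6 ⨾ op sub 7 1 6)
  ⨾ const 6 0 ⨾ const 7 0

writeInstance : Program
writeInstance = writeHeader ⨾ writeStartRule ⨾ writeDummyRule ⨾ writeColumnRules ⨾ writeQueries

row-column-< : ∀ {n d} (x : Fin n) (i : Fin d) → toℕ x * d + toℕ i < n * d
row-column-< {n} {d} x i = begin-strict
  toℕ x * d + toℕ i <⟨ +-monoʳ-< (toℕ x * d) (Fin.toℕ<n i) ⟩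
  toℕ x * d + d     ≡⟨ +-comm (toℕ x * d) d ⟩
  suc (toℕ x) * d   ≤⟨ *-monoˡ-≤ d (Fin.toℕ<n x) ⟩
  n * d             ∎
  where open ≤-Reasoning

record BitMatrix (n d : ℕ) (inp : List ℕ) : Set where
  field
    bit        : Fin n → Fin d → ℕ
    row-count  : cell inp 0 ≡ n
    col-count  : cell inp 1 ≡ d
    bit-at     : ∀ x i → cell inp (2 + (toℕ x * d + toℕ i)) ≡ bit x i
    inp-length : length inp ≡ 2 + n * d

module Writing (w k : ℕ) {n d : ℕ} {inp : List ℕ} (B : BitMatrix n d inp)
               (n< : n < 2 ^ w) (d< : d < 2 ^ w) where

  open BitMatrix B
  open Emission w inp

  block : ℕ
  block = suc d * n

  registersAt : (x₅ x₆ x₇ x₈ x₉ x₁₀ P : ℕ) → List ℕ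
  registersAt x₅ x₆ x₇ x₈ x₉ x₁₀ P =
    1 ∷ n ∷ d ∷ P ∷ k * n ∷ x₅ ∷ x₆ ∷ x₇ ∷ x₈ ∷ x₉ ∷ x₁₀ ∷ suc d ∷ block ∷ 0 ∷ suc (suc d) ∷ []

  outer : (i j : ℕ) → ℕ → List ℕ
  outer i j = registersAt 0 i j 0 0 0

  inner : (i j i′ j′ : ℕ) → ℕ → List ℕ
  inner i j i′ j′ = registersAt 0 i j i′ j′ 0

  idle : ℕ → List ℕ
  idle = outer 0 0

  -- Nonterminal 0 is the start symbol, 1 is Z and 2 + i is Sᵢ, counting coordinates from 0.
  -- Multiplying by the bit selects Z or Sᵢ without a branch; `column-cell` selects letters in the
  -- same way, above the d + 2 nonterminals.
  start-cell : Fin n → Fin d → ℕ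
  start-cell x i = suc (bit x i * suc (toℕ i))

  start-row : Fin n → List ℕ
  start-row x = concat (tabulate λ i → start-cell x i ∷ [])

  start-rule : List ℕ
  start-rule = block ∷ concat (tabulate λ (x : Fin n) → 1 ∷ start-row x)

  dummy-rule : List ℕ
  dummy-rule = n ∷ concat (tabulate {n = n} λ _ → suc (suc d) ∷ [])

  column-cell : Fin d → Fin n → ℕ
  column-cell i x = suc (suc d) + bit x i * suc (toℕ x)

  column : Fin d → List ℕ
  column i = concat (tabulate λ x → column-cell i x ∷ [])

  column-rules : List ℕ
  column-rules = concat (tabulate λ i → n ∷ column i)

  query-list : List ℕ
  query-list = concat (tabulate {n = n} λ x → toℕ x * block ∷ block + toℕ x * block ∷ [])

  header : List ℕ
  header = suc (suc d) ∷ k * n ∷ 0 ∷ k * n ∷ []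

  output : List ℕ
  output = header ++ start-rule ++ dummy-rule ++ column-rules ++ query-list

  bit-address-< : ∀ (x : Fin n) (i : Fin d) → 2 + (toℕ x * d + toℕ i) < length inp
  bit-address-< x i = ≤-trans (+-monoʳ-< 2 (row-column-< x i)) (≤-reflexive (sym inp-length))

  -- The time left open here and below is assembled by unification from the fragments; `writeTime`
  -- spells out the result.
  emits-start-row : ∀ x j → Emits (outer (toℕ x) j) writeStartRow (outer (toℕ x) j) (start-row x) _
  emits-start-row x j =
    subᵉ 9 2 8 (λ _ → z≤n) ⨟ᵉ
    (whileᵉ d (λ i → inner (toℕ x) j i (d ∸ i)) (λ i → start-cell x i ∷ []) {9} d< (λ _ _ → refl) λ i →
      (mulᵉ 5 6 2 ⨟ᵉ addᵉ 5 5 8 ⨟ᵉ addᵉ 5 0 5 ⨟ᵉ addᵉ 5 0 5 ⨟ᵉ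
        loadᵉ 10 5 (2 + (toℕ x * d + toℕ i)) (bit x i) (λ _ → refl) (bit-address-< x i) (bit-at x i) ⨟ᵉ constᵉ 5 0) ⨟ᵉ
      addᵉ 8 0 8 ⨟ᵉ mulᵉ 10 10 8 ⨟ᵉ addᵉ 10 0 10 ⨟ᵉ
      emitᵉ 10 (start-cell x i) (λ _ → refl) (λ _ → refl) (λ _ → refl) (λ _ _ → refl) ⨟ᵉ
      constᵉ 10 0 ⨟ᵉ subᵉ 9 2 8 (λ _ → Fin.toℕ<n i))
    ⨟∅ constᵉ 8 0 ⨟ᵉ constᵉ 9 0

  emits-start-rule : Emits idle writeStartRule idle start-rule _
  emits-start-rule =
    emitᵉ 12 block (λ _ → refl) (λ _ → refl) (λ _ → refl) (λ _ _ → refl) ⨟ᵉ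
    subᵉ 7 1 6 (λ _ → z≤n) ⨟ᵉ
    (whileᵉ n (λ i → outer i (n ∸ i)) (λ (x : Fin n) → 1 ∷ start-row x) {7} n< (λ _ _ → refl) λ x →
      emitᵉ 0 1 (λ _ → refl) (λ _ → refl) (λ _ → refl) (λ _ _ → refl) ⨟ᵉ
      emits-start-row x (n ∸ toℕ x) ⨟∅
      addᵉ 6 0 6 ⨟ᵉ subᵉ 7 1 6 (λ _ → Fin.toℕ<n x))
    ⨟∅ constᵉ 6 0 ⨟ᵉ constᵉ 7 0

  emits-dummy-rule : Emits idle writeDummyRule idle dummy-rule _
  emits-dummy-rule =
    emitᵉ 1 n (λ _ → refl) (λ _ → refl) (λ _ → refl) (λ _ _ → refl) ⨟ᵉ
    subᵉ 9 1 8 (λ _ → z≤n) ⨟ᵉ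
    (whileᵉ n (λ i → inner 0 0 i (n ∸ i)) (λ (_ : Fin n) → suc (suc d) ∷ []) {9} n< (λ _ _ → refl) λ x →
      emitᵉ 14 (suc (suc d)) (λ _ → refl) (λ _ → refl) (λ _ → refl) (λ _ _ → refl) ⨟ᵉ
      addᵉ 8 0 8 ⨟ᵉ subᵉ 9 1 8 (λ _ → Fin.toℕ<n x))
    ⨟∅ constᵉ 8 0 ⨟ᵉ constᵉ 9 0

  emits-column : ∀ i j → Emits (outer (toℕ i) j) writeColumn (outer (toℕ i) j) (column i) _
  emits-column i j =
    subᵉ 9 1 8 (λ _ → z≤n) ⨟ᵉ
    (whileᵉ n (λ x → inner (toℕ i) j x (n ∸ x)) (λ x → column-cell i x ∷ []) {9} n< (λ _ _ → refl) λ x →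
      (mulᵉ 5 8 2 ⨟ᵉ addᵉ 5 5 6 ⨟ᵉ addᵉ 5 0 5 ⨟ᵉ addᵉ 5 0 5 ⨟ᵉ
        loadᵉ 10 5 (2 + (toℕ x * d + toℕ i)) (bit x i) (λ _ → refl) (bit-address-< x i) (bit-at x i) ⨟ᵉ constᵉ 5 0) ⨟ᵉ
      addᵉ 8 0 8 ⨟ᵉ mulᵉ 10 10 8 ⨟ᵉ addᵉ 10 14 10 ⨟ᵉ
      emitᵉ 10 (column-cell i x) (λ _ → refl) (λ _ → refl) (λ _ → refl) (λ _ _ → refl) ⨟ᵉ
      constᵉ 10 0 ⨟ᵉ subᵉ 9 1 8 (λ _ → Fin.toℕ<n x))
    ⨟∅ constᵉ 8 0 ⨟ᵉ constᵉ 9 0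

  emits-column-rules : Emits idle writeColumnRules idle column-rules _
  emits-column-rules =
    subᵉ 7 2 6 (λ _ → z≤n) ⨟ᵉ
    (whileᵉ d (λ i → outer i (d ∸ i)) (λ i → n ∷ column i) {7} d< (λ _ _ → refl) λ i →
      emitᵉ 1 n (λ _ → refl) (λ _ → refl) (λ _ → refl) (λ _ _ → refl) ⨟ᵉ
      emits-column i (d ∸ toℕ i) ⨟∅
      addᵉ 6 0 6 ⨟ᵉ subᵉ 7 2 6 (λ _ → Fin.toℕ<n i))
    ⨟∅ constᵉ 6 0 ⨟ᵉ constᵉ 7 0

  emits-queries : Emits idle writeQueries idle query-list _
  emits-queries =
    subᵉ 7 1 6 (λ _ → z≤n) ⨟ᵉ
    (whileᵉ n (λ i → outer i (n ∸ i)) (λ (x : Fin n) → toℕ x * block ∷ block + toℕ x * block ∷ []) {7} n< (λ _ _ → refl) λ x →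
      mulᵉ 10 6 12 ⨟ᵉ
      emitᵉ 10 (toℕ x * block) (λ _ → refl) (λ _ → refl) (λ _ → refl) (λ _ _ → refl) ⨟ᵉ
      addᵉ 10 12 10 ⨟ᵉ
      emitᵉ 10 (block + toℕ x * block) (λ _ → refl) (λ _ → refl) (λ _ → refl) (λ _ _ → refl) ⨟ᵉ
      constᵉ 10 0 ⨟ᵉ addᵉ 6 0 6 ⨟ᵉ subᵉ 7 1 6 (λ _ → Fin.toℕ<n x))
    ⨟∅ constᵉ 6 0 ⨟ᵉ constᵉ 7 0

  emits-header : Emits idle writeHeader idle header _
  emits-header =
    emitᵉ 14 (suc (suc d)) (λ _ → refl) (λ _ → refl) (λ _ → refl) (λ _ _ → refl) ⨟ᵉ
    emitᵉ 4 (k * n) (λ _ → refl) (λ _ → refl) (λ _ → refl) (λ _ _ → refl) ⨟ᵉ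
    emitᵉ 13 0 (λ _ → refl) (λ _ → refl) (λ _ → refl) (λ _ _ → refl) ⨟ᵉ
    emitᵉ 4 (k * n) (λ _ → refl) (λ _ → refl) (λ _ → refl) (λ _ _ → refl)

  emits-instance : Emits idle writeInstance idle output _
  emits-instance =
    emits-header ⨟ᵉ emits-start-rule ⨟ᵉ emits-dummy-rule ⨟ᵉ emits-column-rules ⨟ᵉ emits-queries

-- The reduction as a program

-- The cells past the end are 0, so copying as many cells as are in use also erases what
-- the moved list leaves behind.
moveDown : Program
moveDown = op mul 5 1 2 ⨾ op add 5 0 5 ⨾ op add 5 0 5 ⨾ op sub 9 3 8 ⨾ while 9
  (op add 10 5 8 ⨾ load 10 10 ⨾ store 8 10 ⨾ const 10 0 ⨾ op add 8 0 8 ⨾ op sub 9 3 8)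

clear : ℕ → Program
clear zero    = skip
clear (suc k) = const k 0 ⨾ clear k

-- Expects all registers to be 0 except `r`, which holds n, and the answer for block i at address i.
-- Register 7 is never written: it serves both as the constant 0 and as the output address 0.
tally : ℕ → Program
tally r = op add 1 r 0 ⨾ const 0 1 ⨾ op add 2 0 1 ⨾ op sub 4 1 3 ⨾ while 4
  (load 6 3 ⨾ op lt 6 6 2 ⨾ op add 5 6 5 ⨾ const 6 0 ⨾ op add 3 0 3 ⨾ op sub 4 1 3)
  ⨾ op lt 6 7 5 ⨾ store 7 6

-- The register that carries n across the call; p does not mention it.
spare : Program → ℕ
spare p = 15 + registers p

-- The first `clear` prepares the call of `p`, the second removes what `p` leaves in registers that
-- `tally` uses. Register 13 is 0, so the addition before them copies n.
reduction : ℕ → Program → Program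
reduction k p = (setup k ⨾ writeInstance ⨾ moveDown ⨾ op add (spare p) 1 13) ⨾
  clear (spare p) ⨾ p ⨾ clear (spare p) ⨾ tally (spare p)

update-same : ∀ (f : ℕ → ℕ) i v → (f [ i ↦ v ]) i ≡ v
update-same f i v with i ≡ᵇ i | ≡⇒≡ᵇ i i refl
... | true | _ = refl

clear-run : ∀ {w} k s → ∃[ s′ ] (w ⊢ clear k , s ⇓[ suc k ] s′) × mem s′ ≡ mem s
  × (∀ r → r < k → reg s′ r ≡ 0) × (∀ r → k ≤ r → reg s′ r ≡ reg s r)
clear-run zero s = s , skip⇓ , refl , (λ _ ()) , λ _ _ → refl
clear-run {w} (suc k) s with clear-run k ⟨ reg s [ k ↦ reduce w 0 ] , mem s ⟩
... | s′ , p⇓ , mem≡ , zeros , others = s′ , seq⇓ const⇓ p⇓ , mem≡ , zeros′ , others′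
  where
  zeros′ : ∀ r → r < suc k → reg s′ r ≡ 0
  zeros′ r (s≤s r≤k) with m≤n⇒m<n∨m≡n r≤k
  ... | inj₁ r<k  = zeros r r<k
  ... | inj₂ refl = trans (others r ≤-refl) (trans (update-same (reg s) r (reduce w 0)) (reduce-zero w))
  others′ : ∀ r → suc k ≤ r → reg s′ r ≡ reg s r
  others′ r k<r = trans (others r (<⇒≤ k<r)) (update-other (reg s) r (>⇒≢ k<r))

-- Memory in the middle of the copying loop: cells below `j` have their new contents, the others
-- still the old ones.
switch : ℕ → (f g : ℕ → ℕ) → ℕ → ℕ
switch j f g i = if i <ᵇ j then f i else g i

switch-< : ∀ {i j} f g → i < j → switch j f g i ≡ f i
switch-< {i} {j} f g i<j with i <ᵇ j | <⇒<ᵇ i<j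
... | true | _ = refl

switch-≥ : ∀ {i j} f g → j ≤ i → switch j f g i ≡ g i
switch-≥ {i} {j} f g j≤i with i <ᵇ j in i<ᵇj
... | true  = contradiction (<ᵇ⇒< i j (subst T (sym i<ᵇj) _)) (≤⇒≯ j≤i)
... | false = refl

switch-suc : ∀ j f g v → v ≡ f j → ∀ i → (switch j f g [ j ↦ v ]) i ≡ switch (suc j) f g i
switch-suc j f g v v≡ i with <-cmp i j
... | tri< i<j i≢j _ = trans (update-other (switch j f g) i i≢j) (trans (switch-< f g i<j) (sym (switch-< f g (m<n⇒m<1+n i<j))))
... | tri≈ _ refl _  = trans (update-same (switch j f g) j v) (trans v≡ (sym (switch-< f g ≤-refl)))
... | tri> _ i≢j j<i = trans (update-other (switch j f g) i i≢j) (trans (switch-≥ f g (<⇒≤ j<i)) (sym (switch-≥ f g j<i)))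

below : (ℕ → ℕ) → ℕ → ℕ → ℕ
below a b zero    = 0
below a b (suc n) = fromBool (a n <ᵇ b) + below a b n

fromBool≤1 : ∀ b → fromBool b ≤ 1
fromBool≤1 true  = ≤-refl
fromBool≤1 false = z≤n

below≤ : ∀ a b n → below a b n ≤ n
below≤ a b zero    = z≤n
below≤ a b (suc n) = +-mono-≤ (fromBool≤1 (a n <ᵇ b)) (below≤ a b n)

module _ (w : ℕ) {n : ℕ} (n< : suc n < 2 ^ w) (a M : ℕ → ℕ)
         (a< : ∀ i → i < n → a i < 2 ^ w) (M≡a : ∀ i → i < n → M i ≡ a i) where

  -- Writing the register as `15 + K` makes `set [] (15 + K) n` unfold to fifteen literal zeros, so
  -- that the steps on small registers compute although `K` is unknown.
  tally-correct : ∀ K → Triple w (set [] (15 + K) n ∣ M) (tally (15 + K))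
    (1 ∷ n ∷ suc n ∷ n ∷ n ∸ n ∷ below a (suc n) n ∷ fromBool (0 <ᵇ below a (suc n) n) ∷
      0 ∷ 0 ∷ 0 ∷ 0 ∷ 0 ∷ 0 ∷ 0 ∷ 0 ∷ set [] K n
     ∣ (M [ 0 ↦ reduce w (fromBool (0 <ᵇ below a (suc n) n)) ])) (5 + (n * 7 + 2))
  tally-correct K = conseq refl (cong (_∣ M) fetched) ≤-refl (addᵗ 1 (15 + K) 0) ⨟
    constᵗ 0 1 ⨟ addᵗ 2 0 1 ⨟ subᵗ 4 1 3 z≤n ⨟
    whileᵗ n (λ i → regs-at i ∣ M) {4} (<-trans ≤-refl n<) (λ _ → refl) (λ i →
      loadᵗ 6 3 (a (toℕ i)) (i< i) (trans (M≡a _ (Fin.toℕ<n i)) (sym (reduce-< w (a< _ (Fin.toℕ<n i))))) ⨟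
      ltᵗ 6 6 2 (a< _ (Fin.toℕ<n i)) n< ⨟ addᵗ 5 6 5 ⨟ constᵗ 6 0 ⨟ addᵗ 3 0 3 ⨟ subᵗ 4 1 3 (Fin.toℕ<n i)) ⨟
    ltᵗ 6 7 5 (m^n>0 2 w) (≤-<-trans (below≤ a (suc n) n) (<-trans ≤-refl n<)) ⨟
    storeᵗ 7 6 (m^n>0 2 w)
    where
    regs-at : ℕ → List ℕ
    regs-at i = 1 ∷ n ∷ suc n ∷ i ∷ n ∸ i ∷ below a (suc n) i ∷ 0 ∷
                0 ∷ 0 ∷ 0 ∷ 0 ∷ 0 ∷ 0 ∷ 0 ∷ 0 ∷ set [] K n
    i< : ∀ (i : Fin n) → toℕ i < 2 ^ w
    i< i = <-trans (Fin.toℕ<n i) (<-trans ≤-refl n<)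
    fetched : set (set [] (15 + K) n) 1 (cell (set [] (15 + K) n) (15 + K) + 0) ≡
              0 ∷ n ∷ 0 ∷ 0 ∷ 0 ∷ 0 ∷ 0 ∷ 0 ∷ 0 ∷ 0 ∷ 0 ∷ 0 ∷ 0 ∷ 0 ∷ 0 ∷ set [] K n
    fetched = cong (λ x → set (set [] (15 + K) n) 1 x)
      (trans (+-identityʳ _) (trans (cell-set [] K n K) (update-same (cell []) K n)))

module Reducing (w k : ℕ) {n d : ℕ} {inp : List ℕ} (B : BitMatrix n d inp)
                (n< : suc n < 2 ^ w) (d< : d < 2 ^ w) where

  open BitMatrix B
  open Emission w inp
  open Writing w k B (<-trans ≤-refl n<) d<

  setup-correct : 2 + n * d ≤ 2 ^ w → Triple w ([] ∣ words w inp) (setup k) (at idle []) 12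
  setup-correct room = conseq refl eqn ≤-refl $
    -- Register 10 is still 0 and register 0 is already 1, so the two loads fetch the cells of n and
    -- d.
    constᵗ 0 1 ⨟ loadᵗ 1 10 n (m^n>0 2 w) (input 0 row-count) ⨟
    loadᵗ 2 0 d (≤-trans (m≤m+n 2 (n * d)) room) (input 1 col-count) ⨟
    constᵗ 4 k ⨟ mulᵗ 4 4 1 ⨟ addᵗ 11 0 2 ⨟ mulᵗ 12 11 1 ⨟ addᵗ 14 0 11 ⨟ constᵗ 13 0 ⨟
    mulᵗ 3 1 2 ⨟ addᵗ 3 0 3 ⨟ addᵗ 3 0 3
    where
    input : ∀ i {v} → cell inp i ≡ v → words w inp i ≡ reduce w v
    input i eqv = trans (cell-map-reduce w inp i) (cong (reduce w) eqv)
    eqn : (idle (2 + n * d) ∣ words w inp) ≡ at idle []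
    eqn rewrite ++-identityʳ inp | inp-length = refl

  total : ℕ
  total = length (inp ++ output)

  -- Source and target overlap, but the source is always `2 + n * d` cells ahead, so it is read
  -- before it is overwritten. Its last reads go past the end of the list, which is why `room`
  -- exceeds `total`.
  move-correct : 2 + n * d + total < 2 ^ w → Triple w (at idle output) moveDown
    (registersAt (2 + n * d) 0 0 total (total ∸ total) 0 total ∣ words w output) (5 + total * 7)
  move-correct room = weaken-memory moved (
    mulᵗ 5 1 2 ⨟ addᵗ 5 0 5 ⨟ addᵗ 5 0 5 ⨟ subᵗ 9 3 8 z≤n ⨟
    whileᵗ total (λ i → registersAt (2 + n * d) 0 0 i (total ∸ i) 0 total ∣ memory-at i) {9}
      (≤-<-trans (m≤n+m total (2 + n * d)) room) (λ _ → refl) (λ i →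
        addᵗ 10 5 8 ⨟
        loadᵗ 10 10 (cell output (toℕ i)) (source< i) (source i) ⨟
        weaken-memory (switch-suc (toℕ i) (words w output) (words w (inp ++ output)) _
                        (sym (cell-map-reduce w output (toℕ i))))
          (storeᵗ 8 10 (<-trans (≤-<-trans (m≤n+m (toℕ i) (2 + n * d)) (+-monoʳ-< (2 + n * d) (Fin.toℕ<n i))) room)) ⨟
        constᵗ 10 0 ⨟ addᵗ 8 0 8 ⨟ subᵗ 9 3 8 (Fin.toℕ<n i)))
    where
    memory-at : ℕ → ℕ → ℕ
    memory-at i = switch i (words w output) (words w (inp ++ output))
    source< : ∀ (i : Fin total) → 2 + n * d + toℕ i < 2 ^ w
    source< i = <-trans (+-monoʳ-< (2 + n * d) (Fin.toℕ<n i)) room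
    source : ∀ (i : Fin total) → memory-at (toℕ i) (2 + n * d + toℕ i) ≡ reduce w (cell output (toℕ i))
    source i = trans (switch-≥ (words w output) (words w (inp ++ output)) (m≤n+m (toℕ i) (2 + n * d)))
      (trans (cell-map-reduce w (inp ++ output) (2 + n * d + toℕ i))
        (cong (reduce w) (trans (cong (λ l → cell (inp ++ output) (l + toℕ i)) (sym inp-length))
          (cell-++ʳ inp output (toℕ i)))))
    moved : ∀ i → memory-at total i ≡ words w output i
    moved i with i <? total
    ... | yes i< = switch-< (words w output) (words w (inp ++ output)) i<
    ... | no  i≮ = trans (switch-≥ (words w output) (words w (inp ++ output)) (≮⇒≥ i≮)) (trans (past (inp ++ output) (≮⇒≥ i≮))
                     (sym (past output (≤-trans (length-++-≤ʳ output {inp}) (≮⇒≥ i≮)))))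
      where
      past : ∀ ys → length ys ≤ i → words w ys i ≡ 0
      past ys ≤i = trans (cell-map-reduce w ys i) (trans (cong (reduce w) (cell-past-end ys ≤i)) (reduce-zero w))

  -- With the loop test included, 14 steps go into a matrix entry, 5 into a letter of the dummy rule
  -- and 10 into a query.
  writeTime : ℕ
  writeTime = 8 + ((2 + (1 + (suc (n * suc (2 + (rowTime d + 2))) + 2)))
    + ((2 + (1 + (suc (n * 5) + 2))) + ((1 + (suc (d * suc (2 + (rowTime n + 2))) + 2))
    + (1 + (suc (n * 10) + 2)))))
    where
    rowTime : ℕ → ℕ
    rowTime l = 1 + (suc (l * 14) + 2)

  time : Program → ℕ → ℕ
  time p F = 12 + (writeTime + ((5 + total * 7) + 1))
    + (suc (spare p) + (F + (suc (spare p) + (5 + (n * 7 + 2)))))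

  prepared : ∀ r → 2 + n * d + total < 2 ^ w →
    Triple w ([] ∣ words w inp) (setup k ⨾ writeInstance ⨾ moveDown ⨾ op add r 1 13)
      (set (registersAt (2 + n * d) 0 0 total (total ∸ total) 0 total) r (n + 0) ∣ words w output)
      (12 + (writeTime + ((5 + total * 7) + 1)))
  prepared r room = setup-correct (≤-trans (m≤m+n _ total) (<⇒≤ room))
    ⨟ emits-instance .emission [] (<⇒≤ (≤-<-trans (m≤n+m total (2 + n * d)) room))
    ⨟ move-correct room
    ⨟ addᵗ r 1 13

  runs : ∀ p {enc F} (a : ℕ → ℕ) →
         2 + n * d + total < 2 ^ w →
         (∀ i → words w output i ≡ cell enc i) →
         (∀ i → i < n → a i < 2 ^ w) →
         (∀ s → Loaded enc s → ∃₂ λ t s′ → (w ⊢ p , s ⇓[ t ] s′) × t ≤ F × (∀ i → i < n → mem s′ i ≡ a i)) →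
         ∀ s → (∀ r → reg s r ≡ 0) → (∀ i → mem s i ≡ words w inp i) →
         ∃₂ λ t s′ → (w ⊢ reduction k p , s ⇓[ t ] s′) × t ≤ time p F
           × mem s′ 0 ≡ reduce w (fromBool (0 <ᵇ below a (suc n) n))
  runs p {enc} {F} a room enc≗ a< solves s regs≡0 mem≗ =
    let t₀ , s₀ , run₀ , t₀≤ , regs₀ , mem₀ =
          prepared R room .Triple.run s ((λ r → trans (regs≡0 r) (sym (reduce-zero w))) , mem≗)
        s₁ , run₁ , mem₁ , zeros₁ , others₁ = clear-run R s₀
        -- Here `p` runs from a fictitious state where even register `R` is 0; `frame` then carries
        -- the run over to the real registers.
        t₂ , s₂ , run₂ , t₂≤ , answers = solves ⟨ (λ _ → 0) , mem s₁ ⟩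
          ((λ _ → refl) , λ i → trans (cong (λ m → m i) mem₁) (trans (mem₀ i) (enc≗ i)))
        f , run₂′ , _ , others₂ = frame run₂ ≤-refl (reg s₁) (λ r r< → zeros₁ r (<-≤-trans r< (m≤n+m K 15)))
        s₃ , run₃ , mem₃ , zeros₃ , others₃ = clear-run R ⟨ f , mem s₂ ⟩
        kept : ∀ r → R ≤ r → reg s₃ r ≡ reg s₀ r
        kept r R≤ = trans (others₃ r R≤) (trans (others₂ r (≤-trans (m≤n+m K 15) R≤)) (others₁ r R≤))
        t₄ , s₄ , run₄ , t₄≤ , _ , mem₄ = tally-correct w n< a (mem s₃) a<
          (λ i i< → trans (cong (λ m → m i) mem₃) (answers i i<)) K .Triple.run s₃
          (saved s₃ zeros₃ (λ r R≤ → trans (kept r R≤) (regs₀ r)) , λ _ → refl)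
    in _ , s₄ , seq⇓ run₀ (seq⇓ run₁ (seq⇓ run₂′ (seq⇓ run₃ run₄))) ,
       +-mono-≤ t₀≤ (+-monoʳ-≤ (suc R) (+-mono-≤ t₂≤ (+-monoʳ-≤ (suc R) t₄≤))) , mem₄ 0
    where
    K = registers p
    R = spare p
    ρ = registersAt (2 + n * d) 0 0 total (total ∸ total) 0 total
    saved : ∀ (s : State) → (∀ r → r < R → reg s r ≡ 0) →
            (∀ r → R ≤ r → reg s r ≡ reduce w (cell (set ρ R (n + 0)) r)) →
            ∀ r → reg s r ≡ reduce w (cell (set [] R n) r)
    saved s zeros kept r = trans (by-position (<-cmp r R)) (cong (reduce w) (sym (cell-set [] R n r)))
      where
      by-position : Tri (r < R) (r ≡ R) (R < r) → reg s r ≡ reduce w ((cell [] [ R ↦ n ]) r)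
      by-position (tri< r<R r≢R _) = trans (zeros r r<R)
        (trans (sym (reduce-zero w)) (cong (reduce w) (sym (update-other (cell []) r r≢R))))
      by-position (tri≈ _ refl _) = trans (kept R ≤-refl) (cong (reduce w)
        (trans (cell-set ρ R (n + 0) R) (trans (update-same (cell ρ) R (n + 0))
          (trans (+-identityʳ n) (sym (update-same (cell []) R n))))))
      by-position (tri> _ r≢R R<r) = trans (kept r (<⇒≤ R<r)) (cong (reduce w)
        (trans (cell-set ρ R (n + 0) r) (trans (update-other (cell ρ) r r≢R)
          (trans (cell-past-end ρ (≤-trans (m≤m+n 15 K) (<⇒≤ R<r))) (sym (update-other (cell []) r r≢R))))))

-- The grammar

module _ {A : Set} where

  take-length-++ : ∀ (xs ys : List A) → take (length xs) (xs ++ ys) ≡ xs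
  take-length-++ []       ys = refl
  take-length-++ (x ∷ xs) ys = cong (x ∷_) (take-length-++ xs ys)

  drop-length-++ : ∀ (xs ys : List A) m → drop (length xs + m) (xs ++ ys) ≡ drop m ys
  drop-length-++ []       ys m = refl
  drop-length-++ (x ∷ xs) ys m = drop-length-++ xs ys m

  length-concat-tabulate : ∀ {n c} (f : Fin n → List A) → (∀ i → length (f i) ≡ c) →
                           length (concat (tabulate f)) ≡ n * c
  length-concat-tabulate {zero}  f len = refl
  length-concat-tabulate {suc n} f len =
    trans (length-++ (f zero)) (cong₂ _+_ (len zero) (length-concat-tabulate (f ∘ suc) (len ∘ suc)))

  length-concatMap : ∀ {B : Set} {c} (f : B → List A) → (∀ i → length (f i) ≡ c) →
                     ∀ xs → length (concatMap f xs) ≡ length xs * c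
  length-concatMap f len []       = refl
  length-concatMap f len (x ∷ xs) =
    trans (length-++ (f x)) (cong₂ _+_ (len x) (length-concatMap f len xs))

  take-drop-concat-tabulate : ∀ {n c} (f : Fin n → List A) → (∀ i → length (f i) ≡ c) →
                              ∀ i → take c (drop (toℕ i * c) (concat (tabulate f))) ≡ f i
  take-drop-concat-tabulate f len zero    rewrite sym (len zero) = take-length-++ (f zero) _
  take-drop-concat-tabulate {c = c} f len (suc i) =
    trans (cong (λ l → take c (drop (l + toℕ i * c) (concat (tabulate f)))) (sym (len zero)))
      (trans (cong (take c) (drop-length-++ (f zero) _ (toℕ i * c)))
        (take-drop-concat-tabulate (f ∘ suc) (len ∘ suc) i))

  concat-tabulate-[-] : ∀ {n} (f : Fin n → A) → concat (tabulate λ i → f i ∷ []) ≡ tabulate f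
  concat-tabulate-[-] f = trans (cong concat (sym (map-tabulate f (_∷ [])))) (concat-map-[_] (tabulate f))

  map-concat-tabulate : ∀ {B : Set} {n} (f : A → B) (g : Fin n → List A) →
                        map f (concat (tabulate g)) ≡ concat (tabulate (map f ∘ g))
  map-concat-tabulate f g = trans (sym (concat-map (tabulate g))) (cong concat (map-tabulate g (map f)))

  concatMap-tabulate : ∀ {B : Set} {n} (f : A → List B) (g : Fin n → A) →
                       concatMap f (tabulate g) ≡ concat (tabulate (f ∘ g))
  concatMap-tabulate f g = cong concat (map-tabulate g f)

  concatMap-concat-tabulate : ∀ {B : Set} {n} (f : A → List B) (g : Fin n → List A) →
    concatMap f (concat (tabulate g)) ≡ concat (tabulate (concatMap f ∘ g))
  concatMap-concat-tabulate {n = zero}  f g = refl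
  concatMap-concat-tabulate {n = suc n} f g = trans (concatMap-++ f (g zero) _)
    (cong (concatMap f (g zero) ++_) (concatMap-concat-tabulate f (g ∘ suc)))

  lookup-tabulate-++ : ∀ {n} (f : Fin n → A) ys (x : Fin n) →
    ∃[ i ] toℕ i ≡ toℕ x × lookup (tabulate f ++ ys) i ≡ f x
  lookup-tabulate-++ f ys zero    = zero , refl , refl
  lookup-tabulate-++ f ys (suc x) with lookup-tabulate-++ (f ∘ suc) ys x
  ... | i , i≡ , eqn = suc i , cong suc i≡ , eqn

sum-tabulate-const : ∀ n c → sum (tabulate {n = n} λ _ → c) ≡ n * c
sum-tabulate-const zero    c = refl
sum-tabulate-const (suc n) c = cong (c +_) (sum-tabulate-const n c)

module Instance {n d σ : ℕ} (A : Vec (Vec (Fin 2) d) n) (n<σ : n < σ) where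

  bitᶠ : Fin n → Fin d → Fin 2
  bitᶠ x i = Vec.lookup (Vec.lookup A x) i

  dummy : Fin σ
  dummy = inject≤ zero n<σ

  letter : Fin 2 → Fin n → Fin σ
  letter zero    y = dummy
  letter (suc _) y = inject≤ (suc y) n<σ

  toℕ-letter : ∀ b y → toℕ (letter b y) ≡ toℕ b * suc (toℕ y)
  toℕ-letter zero       y = Fin.toℕ-inject≤ zero n<σ
  toℕ-letter (suc zero) y = trans (Fin.toℕ-inject≤ (suc y) n<σ) (sym (+-identityʳ _))

  word : Fin (suc d) → List (Fin σ)
  word zero    = tabulate {n = n} λ _ → dummy
  word (suc i) = tabulate λ y → letter (bitᶠ y i) y

  length-word : ∀ j → length (word j) ≡ n
  length-word zero    = length-tabulate _
  length-word (suc i) = length-tabulate _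

  piece : Fin 2 → Fin d → Fin (suc d)
  piece zero    i = zero
  piece (suc _) i = suc i

  toℕ-piece : ∀ b i → toℕ (piece b i) ≡ toℕ b * suc (toℕ i)
  toℕ-piece zero       i = refl
  toℕ-piece (suc zero) i = sym (+-identityʳ _)

  -- The leading Z makes the dummy letter occur in every block, so the threshold n + 1 is the same
  -- for all vectors.
  row : Fin n → List (Fin (suc d))
  row x = zero ∷ tabulate λ i → piece (bitᶠ x i) i

  length-row : ∀ x → length (row x) ≡ suc d
  length-row x = cong suc (length-tabulate (λ i → piece (bitᶠ x i) i))

  rows : List (Fin (suc d))
  rows = concat (tabulate row)

  length-rows : length rows ≡ n * suc d
  length-rows = length-concat-tabulate row length-row

  rules : Fin (suc (suc d)) → List (Fin (suc (suc d)) ⊎ Fin σ)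
  rules zero    = map (inj₁ ∘ suc) rows
  rules (suc j) = map inj₂ (word j)

  increasing : ∀ i j → inj₁ j ∈ rules i → i Fin.< j
  increasing zero    j j∈ with ∈-map⁻ (inj₁ ∘ suc) j∈
  ... | _ , _ , refl = s≤s z≤n
  increasing (suc i) j j∈ with ∈-map⁻ inj₂ j∈
  ... | _ , _ , ()

  grammar : SLG σ
  grammar = record
    { v            = suc (suc d)
    ; start        = zero
    ; rhs          = rules
    ; straightLine = Perm.id , increasing
    }

  open SLG grammar using (_⟶_; rewrite-at; Generates; ∣G∣)

  blockOf : Fin n → List (Fin σ)
  blockOf x = concatMap word (row x)

  text : List (Fin σ)
  text = concat (tabulate blockOf)

  length-blockOf : ∀ x → length (blockOf x) ≡ suc d * n
  length-blockOf x = trans (length-concatMap word length-word (row x)) (cong (_* n) (length-row x))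

  length-text : length text ≡ n * (suc d * n)
  length-text = length-concat-tabulate blockOf length-blockOf

  -- A leftmost derivation; the accumulator `α` holds the text already derived, which is the left
  -- context that `rewrite-at` asks for.
  expand : ∀ α js → Star _⟶_ (map inj₂ α ++ map (inj₁ ∘ suc) js) (map inj₂ (α ++ concatMap word js))
  expand α []       = subst (λ β → Star _⟶_ β (map inj₂ (α ++ []))) (map-++ inj₂ α []) stop
  expand α (j ∷ js) = rewrite-at (map inj₂ α) (suc j) (map (inj₁ ∘ suc) js) ◅
    subst₂ (Star _⟶_)
      (trans (cong (_++ map (inj₁ ∘ suc) js) (map-++ inj₂ α (word j))) (++-assoc (map inj₂ α) _ _))
      (cong (map inj₂) (++-assoc α (word j) _))
      (expand (α ++ word j) js)

  generates : Generates text
  generates = rewrite-at [] zero [] ◅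
    subst₂ (Star _⟶_) (sym (++-identityʳ _))
      (cong (map inj₂) (concatMap-concat-tabulate word row)) (expand [] rows)

  size-grammar : .{{NonZero n}} → ∣G∣ ≡ n * suc d + suc d * n
  size-grammar {{n≢0}} = cong₂ _+_ (trans (cong (_⊔ 1) (trans (length-map _ rows) length-rows)) (m≥n⇒m⊔n≡m (>-nonZero⁻¹ _ {{m*n≢0 n (suc d)}})))
    (trans (cong sum (trans (map-tabulate suc (λ X → length (rules X) ⊔ 1)) (tabulate-cong λ j →
        trans (cong (_⊔ 1) (trans (length-map (inj₂ {A = Fin (suc (suc d))}) (word j)) (length-word j))) (m≥n⇒m⊔n≡m (>-nonZero⁻¹ n)))))
      (sum-tabulate-const (suc d) n))

-- Counting letters

-- Pigeonhole: delete one occurrence of the head from `ys`; by uniqueness the tail of `xs` still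
-- lies in the rest.
unique-⊆-length : ∀ {A : Set} {xs ys : List A} → Unique xs → (∀ {z} → z ∈ xs → z ∈ ys) → length xs ≤ length ys
unique-⊆-length {xs = []}     _              _   = z≤n
unique-⊆-length {xs = x ∷ xs} (x∉xs ∷ xs!) xs⊆ys with ∈-∃++ (xs⊆ys (here refl))
... | ps , qs , refl = ≤-trans (s≤s (unique-⊆-length xs! rest)) (≤-reflexive (sym (length-++-sucʳ ps x qs)))
  where
  rest : ∀ {z} → z ∈ xs → z ∈ ps ++ qs
  rest z∈xs with ∈-++⁻ ps (xs⊆ys (there z∈xs))
  ... | inj₁ z∈ps         = ∈-++⁺ˡ z∈ps
  ... | inj₂ (here refl)  = contradiction refl (All.lookup x∉xs z∈xs)
  ... | inj₂ (there z∈qs) = ∈-++⁺ʳ ps z∈qs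

∙≡0⇒disjoint : ∀ {d} (u v : Vec (Fin 2) d) → ⟨ u ∙ v ⟩ ≡ 0 →
               ∀ i → Vec.lookup u i ≡ suc zero → Vec.lookup v i ≢ suc zero
∙≡0⇒disjoint (suc zero Vec.∷ u) (suc zero Vec.∷ v) () zero refl refl
∙≡0⇒disjoint (a Vec.∷ u) (b Vec.∷ v) ∙≡0 (suc i) = ∙≡0⇒disjoint u v (m+n≡0⇒n≡0 (toℕ a * toℕ b) ∙≡0) i

∙≢0⇒common : ∀ {d} (u v : Vec (Fin 2) d) → ⟨ u ∙ v ⟩ ≢ 0 →
             ∃[ i ] Vec.lookup u i ≡ suc zero × Vec.lookup v i ≡ suc zero
∙≢0⇒common Vec.[] Vec.[] ∙≢0 = contradiction refl ∙≢0
∙≢0⇒common (suc zero Vec.∷ u) (suc zero Vec.∷ v) ∙≢0 = zero , refl , refl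
∙≢0⇒common (zero Vec.∷ u) (b Vec.∷ v) ∙≢0 =
  let i , ui , vi = ∙≢0⇒common u v ∙≢0 in suc i , ui , vi
∙≢0⇒common (suc zero Vec.∷ u) (zero Vec.∷ v) ∙≢0 =
  let i , ui , vi = ∙≢0⇒common u v ∙≢0 in suc i , ui , vi

module Counting {n d σ : ℕ} (A : Vec (Vec (Fin 2) d) n) (n<σ : n < σ) where

  open Instance A n<σ

  letters : List (Fin σ)
  letters = tabulate {n = suc n} λ l → inject≤ l n<σ

  letters! : Unique letters
  letters! = Unique.tabulate⁺ λ {i} {j} → Fin.inject≤-injective n<σ n<σ i j

  length-letters : length letters ≡ suc n
  length-letters = length-tabulate {n = suc n} λ l → inject≤ l n<σ

  blockLetters : Fin n → List (Fin σ)
  blockLetters x = deduplicate Fin._≟_ (blockOf x)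

  inject≤∈letters : ∀ l → inject≤ l n<σ ∈ letters
  inject≤∈letters = ∈-tabulate⁺ {n = suc n} {f = λ l → inject≤ l n<σ}

  letter∈letters : ∀ b y → letter b y ∈ letters
  letter∈letters zero    y = inject≤∈letters zero
  letter∈letters (suc _) y = inject≤∈letters (suc y)

  word⊆letters : ∀ j {c} → c ∈ word j → c ∈ letters
  word⊆letters zero    c∈ with ∈-tabulate⁻ c∈
  ... | y , refl = inject≤∈letters zero
  word⊆letters (suc i) c∈ with ∈-tabulate⁻ c∈
  ... | y , refl = letter∈letters (bitᶠ y i) y

  block∈ : ∀ x {c} → c ∈ blockOf x → ∃[ j ] j ∈ row x × c ∈ word j
  block∈ x c∈ with ∈-concat⁻′ (map word (row x)) c∈
  ... | _ , c∈w , w∈ with ∈-map⁻ word w∈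
  ... | j , j∈ , refl = j , j∈ , c∈w

  blockLetters⊆letters : ∀ x {c} → c ∈ blockLetters x → c ∈ letters
  blockLetters⊆letters x c∈ with block∈ x (∈-deduplicate⁻ Fin._≟_ (blockOf x) c∈)
  ... | j , _ , c∈w = word⊆letters j c∈w

  blockLetters≤ : ∀ x → length (blockLetters x) ≤ suc n
  blockLetters≤ x = subst (length (blockLetters x) ≤_) length-letters
    (unique-⊆-length (deduplicate-! Fin._≟_ (blockOf x)) (blockLetters⊆letters x))

  letter-suc : ∀ b y z → letter b z ≡ inject≤ (suc y) n<σ → b ≡ suc zero × z ≡ y
  letter-suc zero       y z eqn with Fin.inject≤-injective n<σ n<σ zero (suc y) eqn
  ... | ()
  letter-suc (suc zero) y z eqn with Fin.inject≤-injective n<σ n<σ (suc z) (suc y) eqn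
  ... | refl = refl , refl

  piece-suc : ∀ b i {j} → piece b i ≡ suc j → b ≡ suc zero × i ≡ j
  piece-suc (suc zero) i refl = refl , refl

  word-letter : ∀ j y → inject≤ (suc y) n<σ ∈ word j → ∃[ i ] j ≡ suc i × bitᶠ y i ≡ suc zero
  word-letter zero y c∈ with ∈-tabulate⁻ c∈
  ... | z , eqn with letter-suc zero y z (sym eqn)
  ... | () , _
  word-letter (suc i) y c∈ with ∈-tabulate⁻ c∈
  ... | z , eqn with letter-suc (bitᶠ z i) y z (sym eqn)
  ... | b≡1 , refl = i , refl , b≡1

  orthogonal⇒∉ : ∀ x y → ⟨ Vec.lookup A x ∙ Vec.lookup A y ⟩ ≡ 0 → ¬ (inject≤ (suc y) n<σ ∈ blockOf x)
  orthogonal⇒∉ x y ∙≡0 c∈ with block∈ x c∈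
  ... | j , j∈ , c∈w with word-letter j y c∈w
  -- The case `here` cannot arise: it stands for Z, whereas `word-letter` shows the word to be some
  -- Sᵢ.
  orthogonal⇒∉ x y ∙≡0 c∈ | _ , there j∈ , _ | i , refl , yi with ∈-tabulate⁻ j∈
  ... | i′ , eqn with piece-suc (bitᶠ x i′) i′ (sym eqn)
  ... | xi , refl = ∙≡0⇒disjoint (Vec.lookup A x) (Vec.lookup A y) ∙≡0 i xi yi

  -- The letter of `y` is missing from the block; prepended to the distinct letters of the block, it
  -- gives a duplicate-free list that still lies in `letters`.
  orthogonal⇒few : ∀ x y → ⟨ Vec.lookup A x ∙ Vec.lookup A y ⟩ ≡ 0 → length (blockLetters x) < suc n
  orthogonal⇒few x y ∙≡0 = subst (suc (length (blockLetters x)) ≤_) length-letters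
    (unique-⊆-length {xs = inject≤ (suc y) n<σ ∷ blockLetters x}
      (All.tabulate (λ c∈ c≡ → orthogonal⇒∉ x y ∙≡0 (subst (_∈ blockOf x) (sym c≡) (∈-deduplicate⁻ Fin._≟_ (blockOf x) c∈)))
        ∷ deduplicate-! Fin._≟_ (blockOf x))
      λ { (here refl) → inject≤∈letters (suc y) ; (there c∈) → blockLetters⊆letters x c∈ })

  ∈-blockOf : ∀ x j {c} → j ∈ row x → c ∈ word j → c ∈ blockOf x
  ∈-blockOf x j j∈ c∈ = ∈-concat⁺′ c∈ (∈-map⁺ word j∈)

  all-letters : ∀ x → (∀ y → ⟨ Vec.lookup A x ∙ Vec.lookup A y ⟩ ≢ 0) → ∀ l → inject≤ l n<σ ∈ blockOf x
  -- The index `x` itself witnesses that Z has a position.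
  all-letters x none zero = ∈-blockOf x zero (here refl) (∈-tabulate⁺ {n = n} {f = λ _ → dummy} x)
  all-letters x none (suc y) with ∙≢0⇒common (Vec.lookup A x) (Vec.lookup A y) (none y)
  ... | i , xi , yi = ∈-blockOf x (suc i)
    (there (subst (_∈ tabulate (λ i′ → piece (bitᶠ x i′) i′)) (cong (λ b → piece b i) xi) (∈-tabulate⁺ i)))
    (subst (_∈ word (suc i)) (cong (λ b → letter b y) yi) (∈-tabulate⁺ y))

  nonorthogonal⇒many : ∀ x → (∀ y → ⟨ Vec.lookup A x ∙ Vec.lookup A y ⟩ ≢ 0) → suc n ≤ length (blockLetters x)
  nonorthogonal⇒many x none = subst (_≤ length (blockLetters x)) length-letters
    (unique-⊆-length letters! λ c∈ → ∈-deduplicate⁺ Fin._≟_ (present c∈))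
    where
    present : ∀ {c} → c ∈ letters → c ∈ blockOf x
    present c∈ with ∈-tabulate⁻ {n = suc n} {f = λ l → inject≤ l n<σ} c∈
    ... | l , refl = all-letters x none l

below-positive : ∀ a b n i → i < n → a i < b → 0 < below a b n
below-positive a b (suc n) i (s≤s i≤n) ai< with m≤n⇒m<n∨m≡n i≤n
... | inj₁ i<n  = ≤-trans (below-positive a b n i i<n ai<) (m≤n+m _ _)
... | inj₂ refl with a i <ᵇ b | <⇒<ᵇ ai<
... | true | _ = s≤s z≤n

below-zero : ∀ a b n → (∀ i → i < n → b ≤ a i) → below a b n ≡ 0
below-zero a b zero    _   = refl
below-zero a b (suc n) b≤a with a n <ᵇ b in lt≡
... | true  = contradiction (<ᵇ⇒< (a n) b (subst T (sym lt≡) _)) (≤⇒≯ (b≤a n ≤-refl))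
... | false = below-zero a b n λ i i< → b≤a i (m<n⇒m<1+n i<)

-- The encoded instance

module Encoding (k : ℕ) (x : OVInstance) (extra : ℕ) (σ≡ : OVInstance.n x + extra ≡ k * OVInstance.n x)
                (n<σ : OVInstance.n x < k * OVInstance.n x) where

  open OVInstance x renaming (encoding to inp)
  open Instance A n<σ

  private
    rowBits : Vec (Fin 2) d → List ℕ
    rowBits u = map toℕ (Vec.toList u)

    length-rowBits : ∀ u → length (rowBits u) ≡ d
    length-rowBits u = trans (length-map toℕ (Vec.toList u)) (Vec.length-toList u)

  cell-rowBits : ∀ {l} (u : Vec (Fin 2) l) i → cell (map toℕ (Vec.toList u)) (toℕ i) ≡ toℕ (Vec.lookup u i)
  cell-rowBits (a Vec.∷ u) zero    = refl
  cell-rowBits (a Vec.∷ u) (suc i) = cell-rowBits u i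

  length-bits : ∀ {l} (us : Vec (Vec (Fin 2) d) l) → length (concatMap rowBits (Vec.toList us)) ≡ l * d
  length-bits us = trans (length-concatMap rowBits length-rowBits (Vec.toList us)) (cong (_* d) (Vec.length-toList us))

  cell-bits : ∀ {l} (us : Vec (Vec (Fin 2) d) l) y i →
              cell (concatMap rowBits (Vec.toList us)) (toℕ y * d + toℕ i) ≡ toℕ (Vec.lookup (Vec.lookup us y) i)
  cell-bits (u Vec.∷ us) zero i =
    trans (cell-++ˡ (rowBits u) _ (toℕ i) (subst (toℕ i <_) (sym (length-rowBits u)) (Fin.toℕ<n i))) (cell-rowBits u i)
  cell-bits (u Vec.∷ us) (suc y) i = begin
    cell (rowBits u ++ bits) (d + toℕ y * d + toℕ i)
      ≡⟨ cong (cell (rowBits u ++ bits)) (+-assoc d _ _) ⟩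
    cell (rowBits u ++ bits) (d + (toℕ y * d + toℕ i))
      ≡⟨ cong (λ l → cell (rowBits u ++ bits) (l + (toℕ y * d + toℕ i))) (length-rowBits u) ⟨
    cell (rowBits u ++ bits) (length (rowBits u) + (toℕ y * d + toℕ i))
      ≡⟨ cell-++ʳ (rowBits u) bits _ ⟩
    cell bits (toℕ y * d + toℕ i)
      ≡⟨ cell-bits us y i ⟩
    toℕ (Vec.lookup (Vec.lookup us y) i) ∎
    where
    open ≡-Reasoning
    bits = concatMap rowBits (Vec.toList us)

  matrix : BitMatrix n d inp
  matrix = record
    { bit        = λ y i → toℕ (bitᶠ y i)
    ; row-count  = refl
    ; col-count  = refl
    ; bit-at     = cell-bits A
    ; inp-length = cong (2 +_) (length-bits A)
    }

  blockLength : ℕ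
  blockLength = suc d * n

  begin-≤ : ∀ (y : Fin n) → toℕ y * blockLength < suc (length text)
  begin-≤ y = s≤s (subst (toℕ y * blockLength ≤_) (sym length-text) (*-monoˡ-≤ blockLength (<⇒≤ (Fin.toℕ<n y))))

  end-≤ : ∀ (y : Fin n) → blockLength + toℕ y * blockLength < suc (length text)
  end-≤ y = s≤s (subst (blockLength + toℕ y * blockLength ≤_) (sym length-text) (*-monoˡ-≤ blockLength (Fin.toℕ<n y)))

  Query : Set
  Query = Fin (suc (length text)) × Fin (suc (length text))

  query : Fin n → Query
  query y = fromℕ< (begin-≤ y) , fromℕ< (end-≤ y)

  -- Encoded by zeros, hence already in memory without being written.
  padding : List Query
  padding = replicate extra (zero , zero)

  rdc : RDCInstance
  rdc = record
    { σ = k * n ; G = grammar ; T = text ; generates = generates ; queries = tabulate query ++ padding }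

  module R = RDCInstance rdc

  m≡ : R.m ≡ k * n
  m≡ = trans (length-++ (tabulate query)) (trans (cong₂ _+_ (length-tabulate query) (length-replicate extra)) σ≡)

  module _ {w : ℕ} (n< : n < 2 ^ w) (d< : d < 2 ^ w) where

    open Writing w k matrix n< d<

    rule : Fin (suc (suc d)) → List ℕ
    rule X = length (rules X) ∷ map R.encodeSymbol (rules X)

    start-rule≡ : rule zero ≡ start-rule
    start-rule≡ = cong₂ _∷_
      (trans (length-map _ rows) (trans length-rows (*-comm n (suc d))))
      (trans (sym (map-∘ rows)) (trans (map-concat-tabulate (suc ∘ toℕ) row) (cong concat (tabulate-cong λ y →
        cong (1 ∷_) (trans (map-tabulate _ (suc ∘ toℕ)) (trans
          (tabulate-cong λ i → cong suc (toℕ-piece (bitᶠ y i) i))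
          (sym (concat-tabulate-[-] (start-cell y)))))))))

    word-rule≡ : ∀ j (f : Fin n → ℕ) → map (λ a → suc (suc d) + toℕ a) (word j) ≡ tabulate f →
                 rule (suc j) ≡ n ∷ concat (tabulate λ y → f y ∷ [])
    word-rule≡ j f eqn = cong₂ _∷_ (trans (length-map (inj₂ {A = Fin (suc (suc d))}) (word j)) (length-word j))
      (trans (sym (map-∘ (word j))) (trans eqn (sym (concat-tabulate-[-] f))))

    dummy-rule≡ : rule (suc zero) ≡ dummy-rule
    dummy-rule≡ = word-rule≡ zero (λ _ → suc (suc d)) (trans (map-tabulate {n = n} (λ _ → dummy) _)
      (tabulate-cong λ _ → trans (cong (suc (suc d) +_) (Fin.toℕ-inject≤ zero n<σ)) (+-identityʳ _)))

    column-rule≡ : ∀ i → rule (suc (suc i)) ≡ n ∷ column i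
    column-rule≡ i = word-rule≡ (suc i) (column-cell i) (trans (map-tabulate _ _)
      (tabulate-cong λ y → cong (suc (suc d) +_) (toℕ-letter (bitᶠ y i) y)))

    column-rules≡ : concatMap rule (tabulate {n = d} λ i → suc (suc i)) ≡ column-rules
    column-rules≡ = trans (concatMap-tabulate rule λ (i : Fin d) → suc (suc i)) (cong concat (tabulate-cong column-rule≡))

    rules≡ : R.encodeRules ≡ start-rule ++ dummy-rule ++ column-rules
    rules≡ = cong₂ _++_ start-rule≡ (cong₂ _++_ dummy-rule≡ column-rules≡)

    -- Here and in `queries≡` the encoder `f` is abstract: the actual one is an anonymous
    -- pattern-matching function inside `encoding`, supplied by unification.
    padding≡ : (f : Query → List ℕ) → f (zero , zero) ≡ 0 ∷ 0 ∷ [] → ∀ e →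
               concatMap f (replicate e (zero , zero)) ≡ replicate (e * 2) 0
    padding≡ f f0 zero    = refl
    padding≡ f f0 (suc e) = cong₂ _++_ f0 (padding≡ f f0 e)

    queries≡ : (f : Query → List ℕ) → (∀ b e → f (b , e) ≡ toℕ b ∷ toℕ e ∷ []) →
               concatMap f (tabulate query ++ padding) ≡ query-list ++ replicate (extra * 2) 0
    queries≡ f f≡ = trans (concatMap-++ f (tabulate query) padding) (cong₂ _++_
      (trans (concatMap-tabulate f query) (cong concat (tabulate-cong λ y → trans (f≡ _ _)
        (cong₂ (λ b e → b ∷ e ∷ []) (Fin.toℕ-fromℕ< (begin-≤ y)) (Fin.toℕ-fromℕ< (end-≤ y))))))
      (padding≡ f (f≡ zero zero) extra))

    output≡ : output ++ replicate (extra * 2) 0 ≡ R.encoding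
    output≡ = cong₂ (λ μ ys → suc (suc d) ∷ k * n ∷ 0 ∷ μ ∷ ys) (sym m≡) (begin
      (start-rule ++ dummy-rule ++ column-rules ++ query-list) ++ zeros
        ≡⟨ ++-assoc start-rule _ zeros ⟩
      start-rule ++ (dummy-rule ++ column-rules ++ query-list) ++ zeros
        ≡⟨ cong (start-rule ++_) (++-assoc dummy-rule _ zeros) ⟩
      start-rule ++ dummy-rule ++ (column-rules ++ query-list) ++ zeros
        ≡⟨ cong (λ ys → start-rule ++ dummy-rule ++ ys) (++-assoc column-rules _ zeros) ⟩
      start-rule ++ dummy-rule ++ column-rules ++ query-list ++ zeros
        ≡⟨ cong (start-rule ++_) (++-assoc dummy-rule column-rules _) ⟨
      start-rule ++ (dummy-rule ++ column-rules) ++ query-list ++ zeros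
        ≡⟨ ++-assoc start-rule _ _ ⟨
      (start-rule ++ dummy-rule ++ column-rules) ++ query-list ++ zeros
        ≡⟨ cong₂ _++_ (sym rules≡) (sym (queries≡ _ λ _ _ → refl)) ⟩
      R.encodeRules ++ concatMap _ R.queries ∎)
      where
      open ≡-Reasoning
      zeros = replicate (extra * 2) 0

    -- One block more than needed, so that the bound also covers n = 0.
    largest : ℕ
    largest = k * n + (suc (suc d) + n) + suc n * block

    -- The program leaves entries reduced modulo `2 ^ w`, while `Loaded` asks for the entries
    -- themselves; a common bound reconciles the two.
    output-≤ : All (_≤ largest) output
    output-≤ = v≤ ∷ k*n≤ ∷ z≤n ∷ k*n≤ ∷ All.++⁺ (block≤ ∷ each λ y → 1≤ ∷ each λ i → start-cell≤ y i ∷ [])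
      (All.++⁺ (n≤ ∷ each {n} {λ _ → suc (suc d) ∷ []} λ _ → v≤ ∷ [])
      (All.++⁺ (each λ i → n≤ ∷ each λ y → column-cell≤ i y ∷ [])
        (each λ y → query≤ y (<⇒≤ (Fin.toℕ<n y)) ∷ query≤ y (Fin.toℕ<n y) ∷ [])))
      where
      each : ∀ {l} {f : Fin l → List ℕ} → (∀ i → All (_≤ largest) (f i)) → All (_≤ largest) (concat (tabulate f))
      each = All.concat⁺ ∘ All.tabulate⁺
      middle≤ : suc (suc d) + n ≤ largest
      middle≤ = ≤-trans (m≤n+m _ (k * n)) (m≤m+n _ (suc n * block))
      v≤ : suc (suc d) ≤ largest
      v≤ = ≤-trans (m≤m+n _ n) middle≤
      n≤ : n ≤ largest
      n≤ = ≤-trans (m≤n+m n _) middle≤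
      1≤ : 1 ≤ largest
      1≤ = ≤-trans (s≤s z≤n) v≤
      k*n≤ : k * n ≤ largest
      k*n≤ = ≤-trans (m≤m+n (k * n) _) (m≤m+n _ (suc n * block))
      query≤ : ∀ {q} (y : Fin n) → q ≤ n → q * block ≤ largest
      query≤ y q≤n = ≤-trans (*-monoˡ-≤ block (m≤n⇒m≤1+n q≤n)) (m≤n+m (suc n * block) (k * n + (suc (suc d) + n)))
      block≤ : block ≤ largest
      block≤ = ≤-trans (m≤m+n block (n * block)) (m≤n+m (suc n * block) (k * n + (suc (suc d) + n)))
      bit*≤ : ∀ (b : Fin 2) {l c} → suc c ≤ l → toℕ b * suc c ≤ l
      bit*≤ zero       c< = z≤n
      bit*≤ (suc zero) {l} c< = subst (_≤ l) (sym (+-identityʳ _)) c<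
      start-cell≤ : ∀ y i → start-cell y i ≤ largest
      start-cell≤ y i = ≤-trans (s≤s (bit*≤ (bitᶠ y i) (Fin.toℕ<n i))) (≤-trans (n≤1+n _) v≤)
      column-cell≤ : ∀ i y → column-cell i y ≤ largest
      column-cell≤ i y = ≤-trans (+-monoʳ-≤ (suc (suc d)) (bit*≤ (bitᶠ y i) (Fin.toℕ<n y))) middle≤

    words-output : largest < 2 ^ w → ∀ i → words w output i ≡ cell R.encoding i
    words-output largest< i = trans (cong (λ ys → cell ys i) (reduced output output-≤))
      (trans (sym (cell-++-replicate output (extra * 2) i)) (cong (λ ys → cell ys i) output≡))
      where
      reduced : ∀ ys → All (_≤ largest) ys → map (reduce w) ys ≡ ys
      reduced []       []         = refl
      reduced (y ∷ ys) (y≤ ∷ ys≤) = cong₂ _∷_ (reduce-< w (≤-<-trans y≤ largest<)) (reduced ys ys≤)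

    length-output : length output ≡ 4 + ((1 + n * suc d) + ((1 + n * 1) + (d * suc n + n * 2)))
    length-output = cong (4 +_) (trans (length-++ start-rule) (cong₂ _+_
      (cong suc (length-concat-tabulate _ λ y → cong suc
        (trans (length-concat-tabulate (λ i → start-cell y i ∷ []) λ _ → refl) (*-identityʳ d))))
      (trans (length-++ dummy-rule) (cong₂ _+_
        (cong suc (length-concat-tabulate {n = n} (λ _ → suc (suc d) ∷ []) λ _ → refl))
        (trans (length-++ column-rules) (cong₂ _+_
          (length-concat-tabulate _ λ i → cong suc
            (trans (length-concat-tabulate (λ y → column-cell i y ∷ []) λ _ → refl) (*-identityʳ n)))
          (length-concat-tabulate {n = n} _ λ _ → refl)))))))

-- Logarithms and running times

1≤∣↥∣ : ∀ {κ} → 0ℚ <ℚ κ → 1 ≤ ∣ ↥ κ ∣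
1≤∣↥∣ {ℚ.mkℚ (ℤ.+ suc n) _ _}  _ = s≤s z≤n
1≤∣↥∣ {ℚ.mkℚ (ℤ.+ zero)  _ _}  (ℚ.*<* (ℤ.+<+ ()))
1≤∣↥∣ {ℚ.mkℚ ℤ.-[1+ n ]  _ _}  (ℚ.*<* ())

n≤2^⌈log₂n⌉ : ∀ n → n ≤ 2 ^ ⌈log₂ n ⌉
n≤2^⌈log₂n⌉ = <-rec _ step
  where
  open ≤-Reasoning
  step : ∀ n → (∀ {m} → m < n → m ≤ 2 ^ ⌈log₂ m ⌉) → n ≤ 2 ^ ⌈log₂ n ⌉
  step zero            _   = z≤n
  step (suc zero)      _   = s≤s z≤n
  step n@(suc (suc m)) rec = begin
    n                        ≡⟨ ⌊n/2⌋+⌈n/2⌉≡n n ⟨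
    ⌊ n /2⌋ + ⌈ n /2⌉        ≤⟨ +-monoˡ-≤ ⌈ n /2⌉ (⌊n/2⌋≤⌈n/2⌉ n) ⟩
    ⌈ n /2⌉ + ⌈ n /2⌉        ≡⟨ cong (⌈ n /2⌉ +_) (+-identityʳ ⌈ n /2⌉) ⟨
    2 * ⌈ n /2⌉              ≤⟨ *-monoʳ-≤ 2 (rec (⌈n/2⌉<n m)) ⟩
    2 * 2 ^ ⌈log₂ ⌈ n /2⌉ ⌉  ≡⟨ cong (λ l → 2 ^ suc l) (⌈log₂⌈n/2⌉⌉≡⌈log₂n⌉∸1 n) ⟩
    2 ^ suc (⌈log₂ n ⌉ ∸ 1)  ≡⟨ cong (2 ^_) (m+[n∸m]≡n {1} (⌈log₂⌉-mono-≤ {2} {n} (s≤s (s≤s z≤n)))) ⟩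
    2 ^ ⌈log₂ n ⌉            ∎

⌈log₂⌉-≤ : ∀ {n l} → n ≤ 2 ^ l → ⌈log₂ n ⌉ ≤ l
⌈log₂⌉-≤ {n} {l} n≤ = ≤-trans (⌈log₂⌉-mono-≤ n≤) (≤-reflexive (⌈log₂2^n⌉≡n l))

2^⌈log₂n⌉≤2n : ∀ {n} → 1 ≤ n → 2 ^ ⌈log₂ n ⌉ ≤ 2 * n
2^⌈log₂n⌉≤2n {n} 1≤n with ⌈log₂ n ⌉ in l≡
... | zero  = ≤-trans 1≤n (m≤m+n n _)
... | suc l = *-monoʳ-≤ 2 (≮⇒≥ λ n<2^l →
  <⇒≱ (≤-reflexive (sym l≡)) (⌈log₂⌉-≤ {n} (<⇒≤ n<2^l)))

^-distribʳ-* : ∀ o m n → (m * n) ^ o ≡ m ^ o * n ^ o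
^-distribʳ-* zero    m n = refl
^-distribʳ-* (suc o) m n = trans (cong (m * n *_) (^-distribʳ-* o m n)) (interchange m n (m ^ o) (n ^ o))
  where
  interchange : ∀ a b c d → a * b * (c * d) ≡ a * c * (b * d)
  interchange = solve-∀

-- With j = l / (e + 1), l is at most (j + 1)(e + 1) and so at most 2^j (e + 1); raised to the power
-- e + 1, the factor 2^j stays within 2^l.
polylog-≤ : ∀ e l n → 2 ^ l ≤ 2 * n → l ^ suc e ≤ 2 * suc e ^ suc e * n
polylog-≤ e l n 2^l≤ = begin
  l ^ suc e                               ≤⟨ ^-monoˡ-≤ (suc e) l≤ ⟩
  (2 ^ j * suc e) ^ suc e                 ≡⟨ ^-distribʳ-* (suc e) (2 ^ j) (suc e) ⟩
  (2 ^ j) ^ suc e * suc e ^ suc e         ≡⟨ cong (_* suc e ^ suc e) (^-*-assoc 2 j (suc e)) ⟩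
  2 ^ (j * suc e) * suc e ^ suc e         ≤⟨ *-monoˡ-≤ (suc e ^ suc e) (^-monoʳ-≤ 2 (m/n*n≤m l (suc e))) ⟩
  2 ^ l * suc e ^ suc e                   ≤⟨ *-monoˡ-≤ (suc e ^ suc e) 2^l≤ ⟩
  2 * n * suc e ^ suc e                   ≡⟨ rearrange n (suc e ^ suc e) ⟩
  2 * suc e ^ suc e * n                   ∎
  where
  open ≤-Reasoning
  j = l / suc e
  rearrange : ∀ x y → 2 * x * y ≡ 2 * y * x
  rearrange = solve-∀
  l≤ : l ≤ 2 ^ j * suc e
  l≤ = begin
    l                        ≡⟨ m≡m%n+[m/n]*n l (suc e) ⟩
    l % suc e + j * suc e    ≤⟨ +-monoˡ-≤ (j * suc e) (<⇒≤ (m%n<n l (suc e))) ⟩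
    suc j * suc e            ≤⟨ *-monoˡ-≤ (suc e) (n<2^n j) ⟩
    2 ^ j * suc e            ∎

m≤m^n : ∀ m n → .{{NonZero n}} → m ≤ m ^ n
m≤m^n zero    n       = z≤n
m≤m^n (suc m) (suc n) = ≤-trans (≤-reflexive (sym (*-identityʳ (suc m)))) (*-monoʳ-≤ (suc m) (m^n>0 (suc m) n))

module _ (q′ e : ℕ) where

  private
    q = suc q′
    r = q * 2

  polylogConstant : ℕ
  polylogConstant = 2 * (suc e * r) ^ (suc e * r)

  private
    S = polylogConstant

  -- Halving the exponent leaves a spare factor n, which absorbs the powers of log n.
  absorb-polylog : ∀ {n l M F} → 1 ≤ n → 2 ^ l ≤ 2 * n → F ^ q * n ≤ (M * (n ^ 2 * l ^ suc e)) ^ q →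
                   F ^ r * n ≤ (M * S * n ^ 2) ^ r
  absorb-polylog {n} {l} {M} {F} 1≤n 2^l≤ F≤ = *-cancelʳ-≤ _ _ n {{>-nonZero 1≤n}} (begin
    F ^ r * n * n                           ≡⟨ cong (λ x → x * n * n) (^-*-assoc F q 2) ⟨
    (F ^ q) ^ 2 * n * n                     ≡⟨ square (F ^ q) n ⟩
    (F ^ q * n) ^ 2                         ≤⟨ ^-monoˡ-≤ 2 F≤ ⟩
    ((M * (n ^ 2 * l ^ suc e)) ^ q) ^ 2     ≡⟨ ^-*-assoc (M * (n ^ 2 * l ^ suc e)) q 2 ⟩
    (M * (n ^ 2 * l ^ suc e)) ^ r           ≡⟨ cong (_^ r) (*-assoc M (n ^ 2) (l ^ suc e)) ⟨
    (M * n ^ 2 * l ^ suc e) ^ r             ≡⟨ ^-distribʳ-* r (M * n ^ 2) (l ^ suc e) ⟩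
    (M * n ^ 2) ^ r * (l ^ suc e) ^ r       ≡⟨ cong ((M * n ^ 2) ^ r *_) (^-*-assoc l (suc e) r) ⟩
    -- `polylog-≤` takes the exponent minus one, and `suc e * r` unfolds to
    -- `suc (suc (q′ * 2 + e * r))`.
    (M * n ^ 2) ^ r * l ^ (suc e * r)       ≤⟨ *-monoʳ-≤ ((M * n ^ 2) ^ r) (polylog-≤ (suc (q′ * 2 + e * r)) l n 2^l≤) ⟩
    (M * n ^ 2) ^ r * (S * n)               ≡⟨ *-assoc ((M * n ^ 2) ^ r) S n ⟨
    (M * n ^ 2) ^ r * S * n                 ≤⟨ *-monoˡ-≤ n (*-monoʳ-≤ ((M * n ^ 2) ^ r) (m≤m^n S r)) ⟩
    (M * n ^ 2) ^ r * S ^ r * n             ≡⟨ cong (_* n) (^-distribʳ-* r (M * n ^ 2) S) ⟨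
    (M * n ^ 2 * S) ^ r * n                 ≡⟨ cong (λ x → x ^ r * n) (swap M (n ^ 2) S) ⟩
    (M * S * n ^ 2) ^ r * n                 ∎)
    where
    open ≤-Reasoning
    square : ∀ x y → x * (x * 1) * y * y ≡ x * y * (x * y * 1)
    square = solve-∀
    swap : ∀ x y z → x * y * z ≡ x * z * y
    swap = solve-∀

module _ (q′ e M C : ℕ) where

  private
    q = suc q′
    r = q * 2
    S₁ = polylogConstant q′ e
    S₂ = 2 * r ^ r

  -- Trading l^r for S₂ n leaves two surplus factors n, and n² is at most n^r because r = 2 q is at
  -- least 2.
  overhead-≤ : ∀ {n l} → 1 ≤ n → 2 ^ l ≤ 2 * n → (C * (n * l)) ^ r * n ≤ (C * S₂ * n ^ 2) ^ r
  overhead-≤ {n} {l} 1≤n 2^l≤ = begin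
    (C * (n * l)) ^ r * n            ≡⟨ cong (λ x → x ^ r * n) (*-assoc C n l) ⟨
    (C * n * l) ^ r * n              ≡⟨ cong (_* n) (^-distribʳ-* r (C * n) l) ⟩
    (C * n) ^ r * l ^ r * n          ≤⟨ *-monoˡ-≤ n (*-monoʳ-≤ ((C * n) ^ r) (polylog-≤ (suc (q′ * 2)) l n 2^l≤)) ⟩
    (C * n) ^ r * (S₂ * n) * n       ≡⟨ shuffle ((C * n) ^ r) S₂ n ⟩
    (C * n) ^ r * (S₂ * n ^ 2)       ≤⟨ *-monoʳ-≤ ((C * n) ^ r) (*-mono-≤ (m≤m^n S₂ r) (^-monoʳ-≤ n {{>-nonZero 1≤n}} (m≤n*m 2 q))) ⟩
    (C * n) ^ r * (S₂ ^ r * n ^ r)   ≡⟨ cong ((C * n) ^ r *_) (^-distribʳ-* r S₂ n) ⟨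
    (C * n) ^ r * (S₂ * n) ^ r       ≡⟨ ^-distribʳ-* r (C * n) (S₂ * n) ⟨
    (C * n * (S₂ * n)) ^ r           ≡⟨ cong (_^ r) (collect C S₂ n) ⟩
    (C * S₂ * n ^ 2) ^ r             ∎
    where
    open ≤-Reasoning
    shuffle : ∀ x y z → x * (y * z) * z ≡ x * (y * (z * (z * 1)))
    shuffle = solve-∀
    collect : ∀ x y z → x * z * (y * z) ≡ x * y * (z * (z * 1))
    collect = solve-∀

  private
    K = 2 * (M * S₁ + C * S₂)

    double-≤ : ∀ {x k n} → k ≤ M * S₁ + C * S₂ → x ^ r * n ≤ (k * n ^ 2) ^ r → (2 * x) ^ r * n ≤ (K * n ^ 2) ^ r
    double-≤ {x} {k} {n} k≤ x≤ = begin
      (2 * x) ^ r * n                ≡⟨ cong (_* n) (^-distribʳ-* r 2 x) ⟩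
      2 ^ r * x ^ r * n              ≡⟨ *-assoc (2 ^ r) (x ^ r) n ⟩
      2 ^ r * (x ^ r * n)            ≤⟨ *-monoʳ-≤ (2 ^ r) x≤ ⟩
      2 ^ r * (k * n ^ 2) ^ r        ≡⟨ ^-distribʳ-* r 2 (k * n ^ 2) ⟨
      (2 * (k * n ^ 2)) ^ r          ≡⟨ cong (_^ r) (*-assoc 2 k (n ^ 2)) ⟨
      (2 * k * n ^ 2) ^ r            ≤⟨ ^-monoˡ-≤ r (*-monoˡ-≤ (n ^ 2) (*-monoʳ-≤ 2 k≤)) ⟩
      (K * n ^ 2) ^ r                ∎
      where open ≤-Reasoning

  -- Bounding `F + O` by twice the larger summand avoids expanding the power; this is the factor 2
  -- in `K`.
  sum-≤ : ∀ {n l F O} → 1 ≤ n → 2 ^ l ≤ 2 * n → F ^ q * n ≤ (M * (n ^ 2 * l ^ suc e)) ^ q →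
          O ≤ C * (n * l) → (F + O) ^ r * n ≤ (K * n ^ 2) ^ r
  sum-≤ {n} {l} {F} {O} 1≤n 2^l≤ F≤ O≤ with ≤-total O F
  ... | inj₁ O≤F = ≤-trans (*-monoˡ-≤ n (^-monoˡ-≤ r (+-monoʳ-≤ F (≤-trans O≤F (m≤m+n F 0)))))
    (double-≤ {F} {M * S₁} (m≤m+n _ _) (absorb-polylog q′ e {l = l} {M = M} {F = F} 1≤n 2^l≤ F≤))
  ... | inj₂ F≤O = ≤-trans (*-monoˡ-≤ n (^-monoˡ-≤ r (+-mono-≤ F≤O (m≤m+n O 0))))
    (double-≤ {O} {C * S₂} (m≤n+m _ _) (≤-trans (*-monoˡ-≤ n (^-monoˡ-≤ r O≤)) (overhead-≤ {l = l} 1≤n 2^l≤)))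

  sumConstant : ℕ
  sumConstant = K

-- From the query answers to the orthogonality verdict

module Deciding (k : ℕ) (x : OVInstance) (extra : ℕ) (σ≡ : OVInstance.n x + extra ≡ k * OVInstance.n x)
                (n<σ : OVInstance.n x < k * OVInstance.n x) where

  open OVInstance x using (n; d; A; Orthogonal)
  open Instance A n<σ
  open Counting A n<σ
  open Encoding k x extra σ≡ n<σ

  answers : ℕ → ℕ
  answers i = distinct text (i * blockLength) (blockLength + i * blockLength)

  answers≡ : ∀ y → answers (toℕ y) ≡ length (blockLetters y)
  answers≡ y = cong (length ∘ deduplicate Fin._≟_)
    (trans (cong (λ l → take l (drop (toℕ y * blockLength) text)) (m+n∸n≡m blockLength (toℕ y * blockLength)))
      (take-drop-concat-tabulate blockOf length-blockOf y))

  answers≤ : ∀ i → i < n → answers i ≤ suc n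
  answers≤ i i< = subst (λ j → answers j ≤ suc n) (Fin.toℕ-fromℕ< i<)
    (≤-trans (≤-reflexive (answers≡ (fromℕ< i<))) (blockLetters≤ (fromℕ< i<)))

  solution : ∀ {out} → Problem.Correct RDC rdc out → ∀ i → i < n → out i ≡ answers i
  solution {out} correct i i< with lookup-tabulate-++ query padding (fromℕ< i<)
  ... | j , j≡ , query≡ = begin
    out i
      ≡⟨ cong out (trans j≡ (Fin.toℕ-fromℕ< i<)) ⟨
    out (toℕ j)
      ≡⟨ correct j ⟩
    distinct text (toℕ (proj₁ (lookup R.queries j))) (toℕ (proj₂ (lookup R.queries j)))
      ≡⟨ cong (λ q → distinct text (toℕ (proj₁ q)) (toℕ (proj₂ q))) query≡ ⟩
    distinct text (toℕ (fromℕ< (begin-≤ (fromℕ< i<)))) (toℕ (fromℕ< (end-≤ (fromℕ< i<))))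
      ≡⟨ cong₂ (distinct text) (Fin.toℕ-fromℕ< (begin-≤ (fromℕ< i<))) (Fin.toℕ-fromℕ< (end-≤ (fromℕ< i<))) ⟩
    answers (toℕ (fromℕ< i<))
      ≡⟨ cong answers (Fin.toℕ-fromℕ< i<) ⟩
    answers i ∎
    where open ≡-Reasoning

  verdict : ℕ
  verdict = fromBool (0 <ᵇ below answers (suc n) n)

  orthogonal⇒1 : Orthogonal → verdict ≡ 1
  orthogonal⇒1 (u , v , u∈ , v∈ , ∙≡0)
    with below answers (suc n) n | below-positive answers (suc n) n (toℕ y) (Fin.toℕ<n y)
      (subst (_< suc n) (sym (answers≡ y)) (orthogonal⇒few y z (trans (sym (cong₂ ⟨_∙_⟩ (Vec.lookup-index u∈) (Vec.lookup-index v∈))) ∙≡0)))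
    where
    y = Vec.index u∈
    z = Vec.index v∈
  ... | suc _ | _ = refl

  ¬orthogonal⇒0 : ¬ Orthogonal → verdict ≡ 0
  ¬orthogonal⇒0 none = cong (λ c → fromBool (0 <ᵇ c)) (below-zero answers (suc n) n λ i i< →
    subst (λ j → suc n ≤ answers j) (Fin.toℕ-fromℕ< i<)
      (subst (suc n ≤_) (sym (answers≡ (fromℕ< i<))) (nonorthogonal⇒many (fromℕ< i<) λ z ∙≡0 →
        none (_ , _ , Vec.∈-lookup (fromℕ< i<) A , Vec.∈-lookup z A , ∙≡0))))

-- Size bounds

module Bounds (n d k : ℕ) (1≤n : 1 ≤ n) (1≤k : 1 ≤ k) where

  -- One monomial that dominates every size, entry and address. The factor 64 below is above all
  -- coefficients that occur (at most 19) and is `2 ^ 6`, which suits `volume-≤`.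
  volume : ℕ
  volume = k * (n * (n * suc d))

  private
    Q = volume
    instance
      n≢0 : NonZero n
      n≢0 = >-nonZero 1≤n
      k≢0 : NonZero k
      k≢0 = >-nonZero 1≤k

    nnD≤ : n * (suc d * n) ≤ Q
    nnD≤ = ≤-trans (≤-reflexive (cong (n *_) (*-comm (suc d) n))) (m≤n*m _ k)
    nD≤ : n * suc d ≤ Q
    nD≤ = ≤-trans (m≤n*m _ n) (m≤n*m _ k)
    Dn≤ : suc d * n ≤ Q
    Dn≤ = ≤-trans (≤-reflexive (*-comm (suc d) n)) nD≤
    n≤ : n ≤ Q
    n≤ = ≤-trans (m≤m*n n (suc d)) nD≤
    D≤ : suc d ≤ Q
    D≤ = ≤-trans (m≤n*m _ n) nD≤
    kn≤ : k * n ≤ Q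
    kn≤ = *-monoʳ-≤ k (≤-trans (m≤m*n n (suc d)) (m≤n*m _ n))
    nd≤ : n * d ≤ Q
    nd≤ = ≤-trans (*-monoʳ-≤ n (n≤1+n d)) nD≤
    1≤Q : 1 ≤ Q
    1≤Q = ≤-trans 1≤n n≤
    const≤ : ∀ c → c ≤ c * Q
    const≤ c = m≤m*n c Q {{>-nonZero 1≤Q}}
    n*const≤ : ∀ c → n * c ≤ c * Q
    n*const≤ c = ≤-trans (≤-reflexive (*-comm n c)) (*-monoʳ-≤ c n≤)
    dsn≤ : d * suc n ≤ 2 * Q
    dsn≤ = ≤-trans (≤-reflexive (*-suc d n)) (+-mono-≤ (≤-trans (n≤1+n d) D≤)
      (≤-trans (≤-trans (*-monoˡ-≤ n (n≤1+n d)) Dn≤) (m≤m+n Q 0)))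
    up-to-64 : ∀ {c y} → y ≡ c * Q → c ≤ 64 → y ≤ 64 * Q
    up-to-64 y≡ c≤ = ≤-trans (≤-reflexive y≡) (*-monoˡ-≤ Q c≤)

    five : ∀ Q → Q + (Q + Q) + Q + Q ≡ 5 * Q
    five = solve-∀
    eight : ∀ Q → 1 * Q + Q + (1 * Q + Q + Q) + (Q + Q) ≡ 7 * Q
    eight = solve-∀
    nineteen : ∀ Q → 3 * Q + Q + (2 * Q + Q + (4 * Q + (1 * Q + Q + (1 * Q + 1 * Q + (2 * Q + 2 * Q))))) ≡ 19 * Q
    nineteen = solve-∀

  size-≤ : n * (suc d * n) + (n * suc d + suc d * n) + k * n + k * n ≤ 64 * volume
  size-≤ = ≤-trans (+-mono-≤ (+-mono-≤ (+-mono-≤ nnD≤ (+-mono-≤ nD≤ Dn≤)) kn≤) kn≤)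
    (up-to-64 (five Q) (m≤m+n 5 59))

  entries-≤ : k * n + (suc (suc d) + n) + suc n * (suc d * n) < 64 * volume
  entries-≤ = ≤-trans (+-mono-≤ (+-mono-≤ (+-mono-≤ (const≤ 1) kn≤) (+-mono-≤ (+-mono-≤ (const≤ 1) D≤) n≤)) (+-mono-≤ Dn≤ nnD≤))
    (up-to-64 (eight Q) (m≤m+n 7 57))

  addresses-≤ : 2 + n * d + (2 + n * d + (4 + ((1 + n * suc d) + ((1 + n * 1) + (d * suc n + n * 2))))) < 64 * volume
  addresses-≤ = ≤-trans (+-mono-≤ (+-mono-≤ (const≤ 3) nd≤) (+-mono-≤ (+-mono-≤ (const≤ 2) nd≤)
      (+-mono-≤ (const≤ 4) (+-mono-≤ (+-mono-≤ (const≤ 1) nD≤) (+-mono-≤ (+-mono-≤ (const≤ 1) (n*const≤ 1))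
        (+-mono-≤ dsn≤ (n*const≤ 2)))))))
    (up-to-64 (nineteen Q) (m≤m+n 19 45))

  n-≤ : suc n < 64 * volume
  n-≤ = ≤-trans (+-mono-≤ (const≤ 2) n≤) (≤-trans (≤-reflexive (+-comm (2 * Q) Q)) (*-monoˡ-≤ Q (m≤m+n 3 61)))

  d-≤ : d < 64 * volume
  d-≤ = ≤-trans D≤ (≤-trans (m≤m+n Q 0) (*-monoˡ-≤ Q (m≤m+n 1 63)))

  -- Every factor is a power of 2 at most: 64 contributes 6 l to the exponent, k contributes k l,
  -- the two factors n contribute 2 l and d + 1 contributes c l.
  volume-≤ : ∀ c l → 1 ≤ l → n ≤ 2 ^ l → d ≡ c * l → 64 * volume ≤ 2 ^ ((8 + k + c) * l)
  volume-≤ c l 1≤l n≤2^l d≡ = begin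
    2 ^ 6 * (k * (n * (n * suc d)))
      ≤⟨ *-mono-≤ (^-monoʳ-≤ 2 (m≤m*n 6 l)) (*-mono-≤ k≤ (*-mono-≤ n≤2^l (*-mono-≤ n≤2^l D≤2^))) ⟩
    2 ^ (6 * l) * (2 ^ (k * l) * (2 ^ l * (2 ^ l * 2 ^ (c * l))))
      ≡⟨ cong (λ y → 2 ^ (6 * l) * (2 ^ (k * l) * (2 ^ l * y))) (^-distribˡ-+-* 2 l (c * l)) ⟨
    2 ^ (6 * l) * (2 ^ (k * l) * (2 ^ l * 2 ^ (l + c * l)))
      ≡⟨ cong (λ y → 2 ^ (6 * l) * (2 ^ (k * l) * y)) (^-distribˡ-+-* 2 l (l + c * l)) ⟨
    2 ^ (6 * l) * (2 ^ (k * l) * 2 ^ (l + (l + c * l)))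
      ≡⟨ cong (2 ^ (6 * l) *_) (^-distribˡ-+-* 2 (k * l) (l + (l + c * l))) ⟨
    2 ^ (6 * l) * 2 ^ (k * l + (l + (l + c * l)))
      ≡⟨ ^-distribˡ-+-* 2 (6 * l) (k * l + (l + (l + c * l))) ⟨
    2 ^ (6 * l + (k * l + (l + (l + c * l))))
      ≡⟨ cong (2 ^_) (collect k c l) ⟩
    2 ^ ((8 + k + c) * l) ∎
    where
    open ≤-Reasoning
    instance
      l≢0 : NonZero l
      l≢0 = >-nonZero 1≤l
    k≤ : k ≤ 2 ^ (k * l)
    k≤ = ≤-trans (<⇒≤ (n<2^n k)) (^-monoʳ-≤ 2 (m≤m*n k l))
    D≤2^ : suc d ≤ 2 ^ (c * l)
    D≤2^ = subst (λ e → suc e ≤ 2 ^ (c * l)) (sym d≡) (n<2^n (c * l))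
    collect : ∀ k c l → 6 * l + (k * l + (l + (l + c * l))) ≡ (8 + k + c) * l
    collect = solve-∀

-- The sum of the coefficients in time-polynomial below.
overhead : ℕ → ℕ
overhead r = 235 + 2 * r

-- The left side is `time` unfolded, with `total` evaluated and `spare p` and the time of `p` turned
-- into variables, so that the ring solver sees a polynomial.
time-polynomial : ∀ n d r f →
  12 + ((8 + ((2 + (1 + (suc (n * suc (2 + ((1 + (suc (d * 14) + 2)) + 2))) + 2)))
    + ((2 + (1 + (suc (n * 5) + 2))) + ((1 + (suc (d * suc (2 + ((1 + (suc (n * 14) + 2)) + 2))) + 2))
    + (1 + (suc (n * 10) + 2))))))
    + ((5 + (2 + n * d + (4 + ((1 + n * suc d) + ((1 + n * 1) + (d * suc n + n * 2))))) * 7) + 1))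
    + (suc r + (f + (suc r + (5 + (n * 7 + 2)))))
  ≡ f + (111 + 2 * r + 59 * n + 16 * d + 49 * (n * d))
time-polynomial = solve-∀

polynomial-≤ : ∀ n d r → 1 ≤ n → 111 + 2 * r + 59 * n + 16 * d + 49 * (n * d) ≤ overhead r * (n * suc d)
polynomial-≤ n d r 1≤n = ≤-trans
  (+-mono-≤ (+-mono-≤ (+-mono-≤ (m≤m*n (111 + 2 * r) P) (*-monoʳ-≤ 59 (m≤m*n n (suc d))))
      (*-monoʳ-≤ 16 (≤-trans (n≤1+n d) (m≤n*m (suc d) n)))) (*-monoʳ-≤ 49 (*-monoʳ-≤ n (n≤1+n d))))
  (≤-reflexive (collect r P))
  where
  P = n * suc d
  instance
    n≢0 : NonZero n
    n≢0 = >-nonZero 1≤n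
    P≢0 : NonZero P
    P≢0 = m*n≢0 n (suc d)
  collect : ∀ r P → (111 + 2 * r) * P + 59 * P + 16 * P + 49 * P ≡ (235 + 2 * r) * P
  collect = solve-∀

-- Admissibility, word length and running time of the reduction

module Transfer (p : Program) (c₀ c a : ℕ) (1≤c₀ : 1 ≤ c₀) (1≤c : 1 ≤ c) (1≤a : 1 ≤ a) where

  -- Dictated by the queries: |G| is at most 4 c n log n, so m = 4 c a n gives a |G| ≤ m log N. With
  -- σ of the same size, the alphabet condition has a factor 8 c to spare.
  copies : ℕ
  copies = 4 * (c * a)

  -- All numbers that occur are below 2 ^ (wordFactor * log n).
  wordFactor : ℕ
  wordFactor = 8 + copies + c

  private
    instance
      c≢0 : NonZero c
      c≢0 = >-nonZero 1≤c
      a≢0 : NonZero a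
      a≢0 = >-nonZero 1≤a
      c*a≢0 : NonZero (c * a)
      c*a≢0 = m*n≢0 c a
      c₀≢0 : NonZero c₀
      c₀≢0 = >-nonZero 1≤c₀

    4≤copies : 4 ≤ copies
    4≤copies = m≤m*n 4 (c * a)

    1≤copies : 1 ≤ copies
    1≤copies = ≤-trans (m≤m+n 1 3) 4≤copies

  module _ (x : OVInstance) (2≤n : 2 ≤ OVInstance.n x)
           (d≡ : OVInstance.d x ≡ c * ⌈log₂ OVInstance.n x ⌉) where

    open OVInstance x

    private
      l = ⌈log₂ n ⌉
      1≤n : 1 ≤ n
      1≤n = ≤-trans (s≤s z≤n) 2≤n
      instance
        n≢0 : NonZero n
        n≢0 = >-nonZero 1≤n
      1≤l : 1 ≤ l
      1≤l = ⌈log₂⌉-mono-≤ {2} 2≤n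

    extra : ℕ
    extra = pred copies * n

    σ≡ : n + extra ≡ copies * n
    σ≡ = cong (_* n) (suc-pred copies {{>-nonZero 1≤copies}})

    n<σ : n < copies * n
    n<σ = ≤-trans (+-mono-≤ 1≤n (m≤m+n n 0)) (*-monoˡ-≤ n (≤-trans (m≤m+n 2 2) 4≤copies))

    open Encoding copies x extra σ≡ n<σ
    open Instance A n<σ using (size-grammar; length-text; text)
    open Bounds n d copies 1≤n 1≤copies

    target : RDCInstance
    target = rdc

    D≤ : suc d ≤ 2 * (c * l)
    D≤ = ≤-trans (+-mono-≤ (≤-trans 1≤l (m≤n*m l c)) (≤-reflexive d≡))
      (≤-reflexive (cong (c * l +_) (sym (+-identityʳ (c * l)))))

    N≡ : R.N ≡ n * (suc d * n)
    N≡ = length-text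

    size≡ : Problem.size RDC rdc ≡ n * (suc d * n) + (n * suc d + suc d * n) + copies * n + copies * n
    size≡ = cong (_+ copies * n) (cong₂ _+_ (cong₂ _+_ N≡ size-grammar) m≡)

    n≤N : n ≤ R.N
    n≤N = subst (n ≤_) (sym N≡) (m≤m*n n (suc d * n) {{m*n≢0 (suc d) n}})

    n≤size : n ≤ Problem.size RDC rdc
    n≤size = ≤-trans n≤N (≤-trans (m≤m+n R.N R.∣G∣) (≤-trans (m≤m+n _ R.m) (m≤m+n _ R.σ)))

    volume≤ : 64 * volume ≤ 2 ^ (wordFactor * l)
    volume≤ = volume-≤ c l 1≤l (n≤2^⌈log₂n⌉ n) d≡

    log-size≤ : ⌈log₂ Problem.size RDC rdc ⌉ ≤ wordFactor * l
    log-size≤ = ⌈log₂⌉-≤ (≤-trans (≤-reflexive size≡) (≤-trans size-≤ volume≤))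

    log-N≤ : ⌈log₂ R.N ⌉ ≤ wordFactor * l
    log-N≤ = ≤-trans (⌈log₂⌉-mono-≤ (≤-trans (m≤m+n R.N R.∣G∣) (≤-trans (m≤m+n _ R.m) (m≤m+n _ R.σ)))) log-size≤

    ∣G∣≤ : R.∣G∣ ≤ 4 * (c * (n * l))
    ∣G∣≤ = begin
      R.∣G∣                        ≡⟨ size-grammar ⟩
      n * suc d + suc d * n        ≤⟨ +-mono-≤ (*-monoʳ-≤ n D≤) (*-monoˡ-≤ n D≤) ⟩
      n * (2 * (c * l)) + 2 * (c * l) * n ≡⟨ collect n c l ⟩
      4 * (c * (n * l))            ∎
      where
      open ≤-Reasoning
      collect : ∀ n c l → n * (2 * (c * l)) + 2 * (c * l) * n ≡ 4 * (c * (n * l))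
      collect = solve-∀

    n≤∣G∣ : n ≤ R.∣G∣
    n≤∣G∣ = ≤-trans (m≤m*n n (suc d)) (≤-trans (m≤m+n _ (suc d * n)) (≤-reflexive (sym size-grammar)))

    alphabet-large : ∀ b → 1 ≤ b → a ^ 2 * R.N ≤ b ^ 2 * (R.σ ^ 2 * ⌈log₂ R.N ⌉)
    alphabet-large b 1≤b = begin
      a ^ 2 * R.N                                ≡⟨ cong (a ^ 2 *_) N≡ ⟩
      a ^ 2 * (n * (suc d * n))                  ≤⟨ *-monoʳ-≤ (a ^ 2) (*-monoʳ-≤ n (*-monoˡ-≤ n D≤)) ⟩
      a ^ 2 * (n * (2 * (c * l) * n))            ≤⟨ m≤m*n _ (8 * c) {{m*n≢0 8 c}} ⟩
      a ^ 2 * (n * (2 * (c * l) * n)) * (8 * c)  ≡⟨ collect a c n l ⟩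
      R.σ ^ 2 * l                                ≤⟨ *-monoʳ-≤ (R.σ ^ 2) (⌈log₂⌉-mono-≤ n≤N) ⟩
      R.σ ^ 2 * ⌈log₂ R.N ⌉                      ≤⟨ m≤n*m _ (b ^ 2) {{m^n≢0 b 2 {{>-nonZero 1≤b}}}} ⟩
      b ^ 2 * (R.σ ^ 2 * ⌈log₂ R.N ⌉)            ∎
      where
      open ≤-Reasoning
      collect : ∀ a c n l → a * (a * 1) * (n * (2 * (c * l) * n)) * (8 * c)
                ≡ 4 * (c * a) * n * (4 * (c * a) * n * 1) * l
      collect = solve-∀

    queries-many : ∀ b → 1 ≤ b → a * R.∣G∣ ≤ b * (R.m * ⌈log₂ R.N ⌉)
    queries-many b 1≤b = begin
      a * R.∣G∣                        ≤⟨ *-monoʳ-≤ a ∣G∣≤ ⟩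
      a * (4 * (c * (n * l)))          ≡⟨ collect a c n l ⟩
      4 * (c * a) * n * l              ≡⟨ cong (_* l) m≡ ⟨
      R.m * l                          ≤⟨ *-monoʳ-≤ R.m (⌈log₂⌉-mono-≤ n≤N) ⟩
      R.m * ⌈log₂ R.N ⌉                ≤⟨ m≤n*m _ b {{>-nonZero 1≤b}} ⟩
      b * (R.m * ⌈log₂ R.N ⌉)          ∎
      where
      open ≤-Reasoning
      collect : ∀ a c n l → a * (4 * (c * (n * l))) ≡ 4 * (c * a) * n * l
      collect = solve-∀

    module _ {w : ℕ} (long : c₀ * wordFactor * l ≤ w) where

      fits : ∀ {y} → y < 64 * volume → y < 2 ^ w
      fits y< = <-≤-trans y< (≤-trans volume≤ (^-monoʳ-≤ 2 (≤-trans
        (≤-trans (m≤n*m (wordFactor * l) c₀) (≤-reflexive (sym (*-assoc c₀ wordFactor l)))) long)))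

      long-enough : c₀ * ⌈log₂ Problem.size RDC rdc ⌉ ≤ w
      long-enough = ≤-trans (*-monoʳ-≤ c₀ log-size≤) (≤-trans (≤-reflexive (sym (*-assoc c₀ wordFactor l))) long)

      n< : suc n < 2 ^ w
      n< = fits n-≤

      d< : d < 2 ^ w
      d< = fits d-≤

      1<2^w : 1 < 2 ^ w
      1<2^w = ≤-<-trans (s≤s z≤n) n<

      open Reducing w copies matrix n< d<
      open Deciding copies x extra σ≡ n<σ

      total≡ : total ≡ 2 + n * d + (4 + ((1 + n * suc d) + ((1 + n * 1) + (d * suc n + n * 2))))
      total≡ = trans (length-++ encoding) (cong₂ _+_ (BitMatrix.inp-length matrix) (length-output {w} (<-trans ≤-refl n<) d<))

      time-≤ : ∀ F → time p F ≤ F + overhead (spare p) * (n * suc d)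
      time-≤ F = ≤-trans
        (≤-reflexive (trans (cong (λ t → 12 + (writeTime + ((5 + t * 7) + 1))
            + (suc (spare p) + (F + (suc (spare p) + (5 + (n * 7 + 2)))))) total≡)
          (time-polynomial n d (spare p) F)))
        (+-monoʳ-≤ F (polynomial-≤ n d (spare p) 1≤n))

      input-words : ∀ i → cell encoding i ≡ words w encoding i
      input-words i = sym (trans (cell-map-reduce w encoding i) (reduce-< w (small i)))
        where
        bits< : All (_< 2 ^ w) (concatMap (λ u → map toℕ (Vec.toList u)) (Vec.toList A))
        bits< = All.concat⁺ (All.map⁺ (All.universal (λ u → All.map⁺ (All.universal
          (λ β → ≤-<-trans (≤-pred (Fin.toℕ<n β)) 1<2^w) (Vec.toList u))) (Vec.toList A)))
        cell-< : ∀ {ys} → All (_< 2 ^ w) ys → ∀ i → cell ys i < 2 ^ w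
        cell-< []         i       = m^n>0 2 w
        cell-< (y< ∷ ys<) zero    = y<
        cell-< (y< ∷ ys<) (suc i) = cell-< ys< i
        small : ∀ i → cell encoding i < 2 ^ w
        small = cell-< (<-trans ≤-refl n< ∷ d< ∷ bits<)

      transfer : ∀ {F} →
        (∀ s → Loaded R.encoding s →
          ∃₂ λ t s′ → (w ⊢ p , s ⇓[ t ] s′) × t ≤ F × Problem.Correct RDC rdc (mem s′)) →
        ∀ s → Loaded encoding s →
        ∃₂ λ t s′ → (w ⊢ reduction copies p , s ⇓[ t ] s′)
          × t ≤ F + overhead (spare p) * (n * suc d) × Problem.Correct OV x (mem s′)
      transfer {F} solves s (regs≡0 , mem≡) =
        let t , s′ , run , t≤ , out≡ = runs p {R.encoding} {F} answers
              (subst (λ t → 2 + n * d + t < 2 ^ w) (sym total≡) (fits addresses-≤))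
              (words-output {w} (<-trans ≤-refl n<) d< (fits entries-≤))
              (λ i i< → ≤-<-trans (answers≤ i i<) n<)
              (λ s₁ loaded → let t₁ , s₂ , run₁ , t₁≤ , correct = solves s₁ loaded in
                t₁ , s₂ , run₁ , t₁≤ , solution {mem s₂} correct)
              s regs≡0 (λ i → trans (mem≡ i) (input-words i))
        in t , s′ , run , ≤-trans t≤ (time-≤ F) ,
           (λ orth → trans out≡ (trans (cong (reduce w) (orthogonal⇒1 orth)) (reduce-< w 1<2^w))) ,
           (λ ¬orth → trans out≡ (trans (cong (reduce w) (¬orthogonal⇒0 ¬orth)) (reduce-zero w)))

    -- Of the saving |G|^P only one factor n is kept, which P ≥ 1 guarantees for every numerator.
    -- The bound on |G| brings in one more logarithm, hence `suc e`.
    target-time : ∀ q′ P K e F → 1 ≤ P →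
      F ^ suc q′ * R.∣G∣ ^ P ≤ (K * (R.m * R.∣G∣ * ⌈log₂ R.N ⌉ ^ e)) ^ suc q′ →
      F ^ suc q′ * n ≤ (K * (copies * (4 * c)) * wordFactor ^ e * (n ^ 2 * l ^ suc e)) ^ suc q′
    target-time q′ P K e F 1≤P F≤ = begin
      F ^ suc q′ * n                        ≤⟨ *-monoʳ-≤ (F ^ suc q′) (≤-trans n≤∣G∣ (m≤m^n R.∣G∣ P {{>-nonZero 1≤P}})) ⟩
      F ^ suc q′ * R.∣G∣ ^ P                ≤⟨ F≤ ⟩
      (K * (R.m * R.∣G∣ * ⌈log₂ R.N ⌉ ^ e)) ^ suc q′
        ≤⟨ ^-monoˡ-≤ (suc q′) (*-monoʳ-≤ K (*-mono-≤ (*-mono-≤ (≤-reflexive m≡) ∣G∣≤) (^-monoˡ-≤ e log-N≤))) ⟩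
      (K * (copies * n * (4 * (c * (n * l))) * (wordFactor * l) ^ e)) ^ suc q′
        ≡⟨ cong (λ y → (K * (copies * n * (4 * (c * (n * l))) * y)) ^ suc q′) (^-distribʳ-* e wordFactor l) ⟩
      (K * (copies * n * (4 * (c * (n * l))) * (wordFactor ^ e * l ^ e))) ^ suc q′
        ≡⟨ cong (_^ suc q′) (collect K copies c n l (wordFactor ^ e) (l ^ e)) ⟩
      (K * (copies * (4 * c)) * wordFactor ^ e * (n ^ 2 * l ^ suc e)) ^ suc q′ ∎
      where
      open ≤-Reasoning
      collect : ∀ K k c n l E L → K * (k * n * (4 * (c * (n * l))) * (E * L))
                ≡ K * (k * (4 * c)) * E * (n * (n * 1) * (l * L))
      collect = solve-∀

    overhead-time : ∀ r → overhead r * (n * suc d) ≤ overhead r * (2 * c) * (n * l)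
    overhead-time r = ≤-trans (*-monoʳ-≤ (overhead r) (*-monoʳ-≤ n D≤)) (≤-reflexive (collect (overhead r) n c l))
      where
      collect : ∀ o n c l → o * (n * (2 * (c * l))) ≡ o * (2 * c) * (n * l)
      collect = solve-∀

theorem1p7 : OVConjecture → (ε κ : ℚ) → 0ℚ <ℚ ε → 0ℚ <ℚ κ → ¬ SolvableIn (RDCLarge κ) (RDCTime κ ε)
theorem1p7 conjecture ε κ 0<ε 0<κ (p , c₀ , 1≤c₀ , solves) =
  -- The conjecture comes first, since its `c` determines the padding and thereby the program.
  let c , 1≤c , hard = conjecture half-inverse (ℚ.*<* (ℤ.+<+ (s≤s z≤n)))
      open Transfer p c₀ c ∣ ↥ κ ∣ 1≤c₀ 1≤c (1≤∣↥∣ 0<κ)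
      large : ∀ x 2≤n d≡ → Admissible κ (target x 2≤n d≡)
      large x 2≤n d≡ = ≤-trans 2≤n (n≤N x 2≤n d≡) ,
        alphabet-large x 2≤n d≡ (↧ₙ κ) (s≤s z≤n) , queries-many x 2≤n d≡ (↧ₙ κ) (s≤s z≤n)
  -- The lower word-length constant grows by `wordFactor` to fit the larger instance; `c₁` carries
  -- over unchanged because that instance has size at least n.
  in hard (reduction copies p , c₀ * wordFactor , *-mono-≤ 1≤c₀ (s≤s z≤n) , λ c₁ →
    let f , (e , K , N₀ , f≤) , runs = solves c₁
        M = K * (copies * (4 * c)) * wordFactor ^ e
        C = overhead (spare p) * (2 * c)
        image : Problem.Instance (OVLog c) → Problem.Instance (RDCLarge κ)
        image = λ (x , 2≤n , d≡) → target x 2≤n d≡ , large x 2≤n d≡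
        extraTime : OVInstance → ℕ
        extraTime x = overhead (spare p) * (OVInstance.n x * suc (OVInstance.d x))
    in (λ y → f (image y) + extraTime (proj₁ y)) ,
       -- As n ≤ N, the threshold `N₀` for N also works for n.
       (sumConstant q′ e M C , N₀ , λ y@(x , 2≤n , d≡) N₀≤ →
         let n = OVInstance.n x
             1≤n = ≤-trans (s≤s z≤n) 2≤n
         in subst (λ z → (f (image y) + extraTime x) ^ (suc q′ * 2) * z ≤ (sumConstant q′ e M C * n ^ 2) ^ (suc q′ * 2))
              -- The numerator of `half-inverse` is 1, and `n ^ 1` unfolds to `n * 1`.
              (sym (*-identityʳ n))
              (sum-≤ q′ e M C {n} {⌈log₂ n ⌉} {f (image y)} {extraTime x} 1≤n (2^⌈log₂n⌉≤2n 1≤n)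
                (target-time x 2≤n d≡ q′ ∣ ↥ ε ∣ K e (f (image y)) (1≤∣↥∣ 0<ε)
                  (f≤ (image y) (≤-trans N₀≤ (n≤N x 2≤n d≡))))
                (overhead-time x 2≤n d≡ (spare p)))) ,
       λ y@(x , 2≤n , d≡) w long short → transfer x 2≤n d≡ long
         (runs (image y) w (long-enough x 2≤n d≡ long)
           (≤-trans short (*-monoʳ-≤ c₁ (⌈log₂⌉-mono-≤ (n≤size x 2≤n d≡))))))
  where
  q′ : ℕ
  q′ = ℚ.denominator-1 ε
  half-inverse : ℚ
  -- `mkℚ` stores the denominator minus one, so this is 1 / (2 q) with q = `suc q′`.
  half-inverse = ℚ.mkℚ (ℤ.+ 1) (suc (q′ * 2)) (1-coprimeTo _)
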